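{- Let $G$ and $H$ be graphs, each with at least $3$ vertices, and suppose $G$ is connected. Then $$\lambda_3(G\circ H)\ \ge\ \lambda_3(H)+\lambda_3(G)\,|V(H)|.$$ Moreover, this lower bound is sharp: there exist such $G,H$ for which equality holds.
   Context: All graphs are simple, finite and undirected. For a graph $G$ and a set $S\subseteq V(G)$ with $|S|\ge 2$, an $S$-tree (Steiner tree connecting $S$) is a subgraph of $G$ that is a tree containing all vertices of $S$. $\lambda(S)$ (also written $\lambda_G(S)$) is the maximum number of pairwise edge-disjoint $S$-trees in $G$. The generalized $k$-edge-connectivity is $\lambda_k(G)=\min\{\lambda(S): S\subseteq V(G),\ |S|=k\}$, with the convention $\lambda_k(G)=0$ if $G$ is disconnected. The lexicographic product $G\circ H$ has vertex set $V(G)\times V(H)$, and $(u,v)$ is adjacent to $(u',v')$ iff either $uu'\in E(G)$, or $u=u'$ and $vv'\in E(H)$. -}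

module Defs where

open import Data.Empty using (⊥-elim)
open import Data.Fin.Base using (Fin; zero; suc; combine; remQuot)
open import Data.Fin.Properties
  using (_≟_; all?; any?; combine-injective; injective⇒≤; suc-injective)
open import Data.Fin.Subset
  using (Subset; inside; outside; _∈_; _⊆_; ∣_∣; Nonempty)
open import Data.Fin.Subset.Properties
  using (_∈?_; _⊆?_; nonempty?; anySubset?)
open import Data.List.Base as List using (List; []; _∷_; _∷ʳ_; length)
open import Data.List.Relation.Unary.All as All using ()
open import Data.List.Relation.Unary.AllPairs using ([]; _∷_)
open import Data.List.Relation.Unary.Any using (here; there)
open import Data.List.Relation.Unary.Linked using (Linked; linked?)
open import Data.List.Relation.Unary.Unique.Propositional using (Unique)
open import Data.List.Membership.Propositional using () renaming (_∈_ to _∈ˡ_)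
open import Data.List.Membership.Propositional.Properties using (∈-allFin; ∈-lookup)
open import Data.Nat.Base
  using (ℕ; zero; suc; _+_; _*_; _≤_; _<_; z≤n; s≤s; s≤s⁻¹)
open import Data.Nat.Properties as ℕ using (anyUpTo?)
open import Data.Product.Base using (Σ; ∃; ∃₂; _×_; _,_; proj₁; proj₂; map₂)
open import Data.Sum.Base using (_⊎_; inj₁; inj₂; [_,_]′)
open import Data.Vec.Base as Vec using (Vec; []; _∷_; lookup; tabulate; here; there)
open import Data.Vec.Properties using (lookup∘tabulate; toList∘fromList)
open import Function.Base using (_on_)
open import Level using (0ℓ)
open import Relation.Binary.Construct.Closure.ReflexiveTransitive
  using (Star; ε; _◅_; _◅◅_)
open import Relation.Binary.Core using (Rel; _⇒_)
open import Relation.Binary.Definitions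
  using (Symmetric; Irreflexive; Decidable)
open import Relation.Binary.PropositionalEquality
  using (_≡_; _≢_; refl; sym; trans; cong; subst)
open import Relation.Nullary.Decidable
  using (Dec; yes; no; map′; ¬?; _×-dec_; _⊎-dec_; _→-dec_)
open import Relation.Nullary.Negation using (¬_; contradiction)
import Relation.Unary as U
import Data.List.Relation.Unary.Unique.DecPropositional as DecUnique

private
  variable
    n m k t : ℕ

record Graph (n : ℕ) : Set₁ where
  field
    Adj    : Rel (Fin n) 0ℓ
    adj?   : Decidable Adj
    symm   : Symmetric Adj
    irrefl : Irreflexive _≡_ Adj

open Graph public

Connected : Graph n → Set
Connected G = ∀ x y → Star (Adj G) x y

LexAdj : Graph n → Graph m → Rel (Fin n × Fin m) 0ℓ
LexAdj G H (u , v) (u′ , v′) = Adj G u u′ ⊎ (u ≡ u′ × Adj H v v′)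

-- The vertex set Fin n × Fin m is identified with Fin (n * m) by the
-- standard library's bijection remQuot (inverse: combine).

infixr 9 _∘ₗ_

_∘ₗ_ : Graph n → Graph m → Graph (n * m)
_∘ₗ_ {n} {m} G H = record
  { Adj    = LexAdj G H on remQuot {n} m
  ; adj?   = λ a b → adj? G _ _ ⊎-dec (_ ≟ _ ×-dec adj? H _ _)
  ; symm   = λ where
      (inj₁ e)       → inj₁ (symm G e)
      (inj₂ (p , e)) → inj₂ (sym p , symm H e)
  ; irrefl = λ where
      refl (inj₁ e)       → irrefl G refl e
      refl (inj₂ (_ , e)) → irrefl H refl e
  }

-- The edge set is given by its neighbourhoods: x and y are joined by an
-- edge of the subgraph iff y ∈ lookup nbrs x.

record Subgraph (G : Graph n) : Set where
  field
    verts : Subset n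
    nbrs  : Vec (Subset n) n

  Edge : Rel (Fin n) 0ℓ
  Edge x y = y ∈ lookup nbrs x

  field
    edge-symm : Symmetric Edge
    edge⇒adj  : Edge ⇒ Adj G
    edge⇒vert : ∀ {x y} → Edge x y → x ∈ verts

open Subgraph public

-- The cycle visits x, then the vertices of xs in order, then x again.

record IsCycle {A : Set} (R : Rel A 0ℓ) (x : A) (xs : List A) : Set where
  field
    long     : 3 ≤ length (x ∷ xs)
    distinct : Unique (x ∷ xs)
    closed   : Linked R (x ∷ xs ∷ʳ x)

record IsTree (V : Subset n) (E : Rel (Fin n) 0ℓ) : Set where
  field
    nonempty  : Nonempty V
    connected : ∀ {x y} → x ∈ V → y ∈ V → Star E x y
    acyclic   : ∀ x xs → ¬ IsCycle E x xs

IsSteinerTree : {G : Graph n} → Subset n → Subgraph G → Set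
IsSteinerTree S T = S ⊆ verts T × IsTree (verts T) (Edge T)

EdgeDisjoint : {G : Graph n} → Subgraph G → Subgraph G → Set
EdgeDisjoint T T′ = ∀ x y → ¬ (Edge T x y × Edge T′ x y)

record Packing (G : Graph n) (S : Subset n) (t : ℕ) : Set where
  field
    tree     : Fin t → Subgraph G
    steiner  : ∀ i → IsSteinerTree S (tree i)
    disjoint : ∀ i j → i ≢ j → EdgeDisjoint (tree i) (tree j)

IsMaximum : (ℕ → Set) → ℕ → Set
IsMaximum P a = P a × (∀ b → P b → b ≤ a)

IsMinimum : (ℕ → Set) → ℕ → Set
IsMinimum P a = P a × (∀ b → P b → a ≤ b)

IsLocalλ : Graph n → Subset n → ℕ → Set
IsLocalλ G S = IsMaximum (Packing G S)

Isλ : ℕ → Graph n → ℕ → Set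
Isλ k G a =
    (Connected G × IsMinimum (λ b → ∃ λ S → ∣ S ∣ ≡ k × IsLocalλ G S b) a)
  ⊎ (¬ Connected G × a ≡ 0)

maximum : {P : ℕ → Set} → U.Decidable P → P 0 →
          ∀ B → (∀ b → P b → b ≤ B) → ∃ (IsMaximum P)
maximum P? p₀ zero    bd = 0 , p₀ , bd
maximum P? p₀ (suc B) bd with P? (suc B)
... | yes p = suc B , p , bd
... | no ¬p = maximum P? p₀ B λ b pb →
  s≤s⁻¹ (ℕ.≤∧≢⇒< (bd b pb) λ { refl → ¬p pb })

minimum : {P : ℕ → Set} → U.Decidable P → ∀ {a} → P a → ∃ (IsMinimum P)
minimum {P} P? {a} pa = up a 0 (λ _ _ → z≤n) (a , pa , ℕ.≤-refl)
  where
  up : ∀ fuel c → (∀ b → P b → c ≤ b) → ∃ (λ d → P d × d ≤ c + fuel) →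
       ∃ (IsMinimum P)
  up fuel c lb (d , pd , d≤) with P? c
  ... | yes pc = c , pc , lb
  up zero c lb (d , pd , d≤) | no ¬pc =
    contradiction (subst P (ℕ.≤-antisym (subst (d ≤_) (ℕ.+-identityʳ c) d≤) (lb d pd)) pd) ¬pc
  up (suc fuel) c lb (d , pd , d≤) | no ¬pc =
    up fuel (suc c) (λ b pb → ℕ.≤∧≢⇒< (lb b pb) λ { refl → ¬pc pb })
       (d , pd , subst (d ≤_) (ℕ.+-suc c fuel) d≤)

Searchable : Set → Set₁
Searchable A = {P : A → Set} → U.Decidable P → Dec (∃ P)

search-Vec : {A : Set} → Searchable A → ∀ k → Searchable (Vec A k)
search-Vec s zero    P? = map′ ([] ,_) (λ { ([] , p) → p }) (P? [])
search-Vec s (suc k) P? =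
  map′ (λ { (x , xs , p) → x ∷ xs , p }) (λ { (x ∷ xs , p) → x , xs , p })
    (s λ x → search-Vec s k λ xs → P? (x ∷ xs))

lookup-injective : {xs : List (Fin n)} → Unique xs → ∀ {i j} →
                   List.lookup xs i ≡ List.lookup xs j → i ≡ j
lookup-injective (_  ∷ _)  {zero}  {zero}  _  = refl
lookup-injective {xs = x ∷ xs} (px ∷ _) {zero}  {suc j} eq =
  contradiction eq (All.lookup px (∈-lookup j))
lookup-injective {xs = x ∷ xs} (px ∷ _) {suc i} {zero}  eq =
  contradiction (sym eq) (All.lookup px (∈-lookup i))
lookup-injective (_ ∷ u)   {suc i} {suc j} eq = cong suc (lookup-injective u eq)

-- Reach vs x y: some walk from x to y has all inner vertices in vs
-- (Warshall's algorithm).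

module _ {E : Rel (Fin n) 0ℓ} (E? : Decidable E) where

  Reach : List (Fin n) → Rel (Fin n) 0ℓ
  Reach []       x y = x ≡ y ⊎ E x y
  Reach (v ∷ vs) x y = Reach vs x y ⊎ (Reach vs x v × Reach vs v y)

  reach? : ∀ vs → Decidable (Reach vs)
  reach? []       x y = x ≟ y ⊎-dec E? x y
  reach? (v ∷ vs) x y = reach? vs x y ⊎-dec (reach? vs x v ×-dec reach? vs v y)

  reach⇒star : ∀ vs → Reach vs ⇒ Star E
  reach⇒star []       (inj₁ refl)    = ε
  reach⇒star []       (inj₂ e)       = e ◅ ε
  reach⇒star (v ∷ vs) (inj₁ r)       = reach⇒star vs r
  reach⇒star (v ∷ vs) (inj₂ (r , s)) = reach⇒star vs r ◅◅ reach⇒star vs s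

  base⇒reach : ∀ vs → Reach [] ⇒ Reach vs
  base⇒reach []       r = r
  base⇒reach (v ∷ vs) r = inj₁ (base⇒reach vs r)

  reach-trans : ∀ vs {x y z} → y ∈ˡ vs → Reach vs x y → Reach vs y z → Reach vs x z
  reach-trans (v ∷ vs) (here refl) p q =
    inj₂ ([ (λ r → r) , proj₁ ]′ p , [ (λ r → r) , proj₂ ]′ q)
  reach-trans (v ∷ vs) (there y∈) (inj₁ p)       (inj₁ q)       = inj₁ (reach-trans vs y∈ p q)
  reach-trans (v ∷ vs) (there y∈) (inj₁ p)       (inj₂ (q , s)) = inj₂ (reach-trans vs y∈ p q , s)
  reach-trans (v ∷ vs) (there y∈) (inj₂ (r , p)) (inj₁ q)       = inj₂ (r , reach-trans vs y∈ p q)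
  reach-trans (v ∷ vs) (there y∈) (inj₂ (r , _)) (inj₂ (_ , s)) = inj₂ (r , s)

  star⇒reach : Star E ⇒ Reach (List.allFin n)
  star⇒reach ε                   = base⇒reach _ (inj₁ refl)
  star⇒reach (_◅_ {j = j} e es) =
    reach-trans _ (∈-allFin j) (base⇒reach _ (inj₂ e)) (star⇒reach es)

  star? : Decidable (Star E)
  star? x y = map′ (reach⇒star _) star⇒reach (reach? (List.allFin n) x y)

  cycle? : ∀ x xs → Dec (IsCycle E x xs)
  cycle? x xs =
    map′ (λ (l , d , c) → record { long = l ; distinct = d ; closed = c })
         (λ c → IsCycle.long c , IsCycle.distinct c , IsCycle.closed c)
      (3 ℕ.≤? _ ×-dec DecUnique.unique? _≟_ _ ×-dec linked? E? _)

  hasCycle? : Dec (∃₂ (IsCycle E))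
  hasCycle? = map′ (λ (x , _ , _ , xs , c) → x , Vec.toList xs , c) bounded
    (any? λ x → anyUpTo? (λ k → search-Vec any? k λ xs → cycle? x (Vec.toList xs)) n)
    where
    bounded : ∃₂ (IsCycle E) →
              ∃ λ x → ∃ λ k → k < n × ∃ λ (xs : Vec (Fin n) k) → IsCycle E x (Vec.toList xs)
    bounded (x , xs , c) =
      x , length xs , injective⇒≤ (lookup-injective (IsCycle.distinct c)) ,
      Vec.fromList xs , subst (IsCycle E x) (sym (toList∘fromList xs)) c

  tree? : ∀ V → Dec (IsTree V E)
  tree? V =
    map′ (λ (ne , c , a) → record
           { nonempty = ne ; connected = λ {x} {y} → c x y
           ; acyclic = λ x xs cyc → a (x , xs , cyc) })
         (λ T → let open IsTree T in
           nonempty , (λ x y → connected) , λ (x , xs , cyc) → acyclic x xs cyc)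
      (nonempty? V
        ×-dec all? (λ x → all? λ y → (x ∈? V) →-dec ((y ∈? V) →-dec star? x y))
        ×-dec ¬? hasCycle?)

module _ (G : Graph n) (S : Subset n) where

  Raw : Set
  Raw = Vec (Subset n) (suc n)

  RawEdge : Raw → Rel (Fin n) 0ℓ
  RawEdge r x y = y ∈ lookup (Vec.tail r) x

  rawEdge? : ∀ r → Decidable (RawEdge r)
  rawEdge? r x y = y ∈? lookup (Vec.tail r) x

  Valid : Raw → Set
  Valid r = Σ (Subgraph G) λ T → verts T ∷ nbrs T ≡ r × IsSteinerTree S T

  valid? : U.Decidable Valid
  valid? r@(V ∷ N) =
    map′ (λ (s , a , v , t) →
           record { verts = V ; nbrs = N ; edge-symm = λ {x} {y} → s x y
                  ; edge⇒adj = λ {x} {y} → a x y ; edge⇒vert = λ {x} {y} → v x y }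
           , refl , t)
         (λ { (T , refl , t) →
           (λ x y → edge-symm T) , (λ x y → edge⇒adj T) , (λ x y → edge⇒vert T) , t })
      (  all? (λ x → all? λ y → E? x y →-dec E? y x)
       ×-dec all? (λ x → all? λ y → E? x y →-dec adj? G x y)
       ×-dec all? (λ x → all? λ y → E? x y →-dec (x ∈? V))
       ×-dec ((S ⊆? V) ×-dec tree? E? V))
    where E? = rawEdge? r

  RawPacking : Vec Raw t → Set
  RawPacking rs = (∀ i → Valid (lookup rs i))
    × (∀ i j → i ≢ j → ∀ x y → ¬ (RawEdge (lookup rs i) x y × RawEdge (lookup rs j) x y))

  packing? : U.Decidable (Packing G S)
  packing? t = map′ to from (search-Vec (search-Vec anySubset? (suc n)) t λ rs →
      all? (λ i → valid? (lookup rs i))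
      ×-dec all? (λ i → all? λ j → ¬? (i ≟ j) →-dec
             all? (λ x → all? λ y → ¬? (rawEdge? (lookup rs i) x y ×-dec rawEdge? (lookup rs j) x y))))
    where
    to : ∃ RawPacking → Packing G S t
    to (rs , v , d) = record
      { tree     = λ i → proj₁ (v i)
      ; steiner  = λ i → proj₂ (proj₂ (v i))
      ; disjoint = λ i j i≢j x y (e , e′) →
          d i j i≢j x y (conv (proj₁ (v i)) (proj₁ (proj₂ (v i))) e , conv (proj₁ (v j)) (proj₁ (proj₂ (v j))) e′)
      }
      where
      conv : ∀ (T : Subgraph G) {r x y} → verts T ∷ nbrs T ≡ r → Edge T x y → RawEdge r x y
      conv T refl e = e

    from : Packing G S t → ∃ RawPacking
    from p = tabulate raw
           , (λ i → tree i , sym (lookup∘tabulate raw i) , steiner i)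
           , λ i j i≢j x y (e , e′) → disjoint i j i≢j x y
               ( subst (λ r → RawEdge r x y) (lookup∘tabulate raw i) e
               , subst (λ r → RawEdge r x y) (lookup∘tabulate raw j) e′)
      where
      open Packing p
      raw : Fin t → Raw
      raw i = verts (tree i) ∷ nbrs (tree i)

  empty : Packing G S 0
  empty = record { tree = λ () ; steiner = λ () ; disjoint = λ () }

member : (S : Subset n) → 1 ≤ ∣ S ∣ → Nonempty S
member (inside  ∷ S) _ = zero , here
member (outside ∷ S) l = let x , x∈ = member S l in suc x , there x∈

twoMembers : (S : Subset n) → 2 ≤ ∣ S ∣ → ∃₂ λ x y → x ≢ y × x ∈ S × y ∈ S
twoMembers (inside  ∷ S) (s≤s l) =
  let y , y∈ = member S l in zero , suc y , (λ ()) , here , there y∈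
twoMembers (outside ∷ S) l =
  let x , y , x≢y , x∈ , y∈ = twoMembers S l
  in suc x , suc y , (λ eq → x≢y (suc-injective eq)) , there x∈ , there y∈

subsetOfSize : k ≤ n → ∃ λ (S : Subset n) → ∣ S ∣ ≡ k
subsetOfSize {n = zero}  z≤n     = [] , refl
subsetOfSize {n = suc n} z≤n     = let S , p = subsetOfSize z≤n in outside ∷ S , p
subsetOfSize             (s≤s l) = let S , p = subsetOfSize l in inside ∷ S , cong suc p

packing-bound : (G : Graph n) (S : Subset n) → 2 ≤ ∣ S ∣ → ∀ t → Packing G S t → t ≤ n * n
packing-bound {n} G S 2≤ t p = injective⇒≤ {f = λ i → combine (proj₁ (edge i)) (proj₁ (proj₂ (edge i)))} inj
  where
  open Packing p
  firstEdge : {E : Rel (Fin n) 0ℓ} → ∀ {x y} → x ≢ y → Star E x y → ∃₂ E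
  firstEdge x≢y ε       = contradiction refl x≢y
  firstEdge _   (e ◅ _) = _ , _ , e

  edge : ∀ i → ∃₂ (Edge (tree i))
  edge i = let x , y , x≢y , x∈ , y∈ = twoMembers S 2≤
               S⊆ , T = steiner i
           in firstEdge x≢y (IsTree.connected T (S⊆ x∈) (S⊆ y∈))

  inj : ∀ {i j} → combine (proj₁ (edge i)) (proj₁ (proj₂ (edge i)))
                ≡ combine (proj₁ (edge j)) (proj₁ (proj₂ (edge j))) → i ≡ j
  inj {i} {j} eq with i ≟ j
  ... | yes i≡j = i≡j
  ... | no i≢j  = ⊥-elim (clash (edge i) (edge j) (combine-injective _ _ _ _ eq))
    where
    clash : (e : ∃₂ (Edge (tree i))) (e′ : ∃₂ (Edge (tree j))) →
            ¬ (proj₁ e ≡ proj₁ e′ × proj₁ (proj₂ e) ≡ proj₁ (proj₂ e′))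
    clash (x , y , e) (_ , _ , e′) (refl , refl) = disjoint i j i≢j x y (e , e′)

-- Opaque so that type checking never runs the exhaustive search; λ-spec
-- below determines the value.

opaque

  localλ-exists : (G : Graph n) (S : Subset n) → 2 ≤ ∣ S ∣ → ∃ (IsLocalλ G S)
  localλ-exists G S 2≤ =
    maximum (packing? G S) (empty G S) _ (packing-bound G S 2≤)

  λ-exists : ∀ k (G : Graph n) → 2 ≤ k → k ≤ n → ∃ (Isλ k G)
  λ-exists {n} k G 2≤k k≤n with all? (λ x → all? (star? (adj? G) x))
  ... | no ¬c = 0 , inj₂ (¬c , refl)
  ... | yes c = map₂ (λ q → inj₁ (c , q)) (minimum attained? (proj₂ attained))
    where
    Attained : ℕ → Set
    Attained b = ∃ λ S → ∣ S ∣ ≡ k × IsLocalλ G S b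

    attained : ∃ Attained
    attained = let S , p = subsetOfSize k≤n
                   b , q = localλ-exists G S (subst (2 ≤_) (sym p) 2≤k)
               in b , S , p , q

    isLocalλ? : ∀ b S → ∣ S ∣ ≡ k → Dec (IsLocalλ G S b)
    isLocalλ? b S p with localλ-exists G S (subst (2 ≤_) (sym p) 2≤k)
    ... | a , pa , ub with b ℕ.≟ a
    ...   | yes refl = yes (pa , ub)
    ...   | no b≢a   = no λ (pb , ub′) → b≢a (ℕ.≤-antisym (ub b pb) (ub′ a pa))

    attained? : U.Decidable Attained
    attained? b = anySubset? dec
      where
      dec : ∀ S → Dec (∣ S ∣ ≡ k × IsLocalλ G S b)
      dec S with ∣ S ∣ ℕ.≟ k
      ... | no ≢k = no λ (p , _) → ≢k p
      ... | yes p = map′ (p ,_) proj₂ (isLocalλ? b S p)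

-- λ[ k ] G is only meaningful for 2 ≤ k ≤ n; outside this range it is 0.

infix 10 λ[_]_

λ[_]_ : ℕ → Graph n → ℕ
λ[_]_ {n} k G with 2 ℕ.≤? k ×-dec k ℕ.≤? n
... | yes (2≤k , k≤n) = proj₁ (λ-exists k G 2≤k k≤n)
... | no _            = 0

λ-spec : (G : Graph n) → 2 ≤ k → k ≤ n → Isλ k G (λ[ k ] G)
λ-spec {n} {k} G 2≤k k≤n with 2 ℕ.≤? k ×-dec k ℕ.≤? n
... | yes (2≤k , k≤n) = proj₂ (λ-exists k G 2≤k k≤n)
... | no out          = contradiction (2≤k , k≤n) out

{-# OPTIONS --safe #-}

-- It suffices to colour edges of G ∘ H so that every colour class joins the three given vertices
-- (u k , a k); spanning trees of the classes then form the packing.  Let T i (i < ℓ) be disjoint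
-- edge sets of G joining the u k, and B e (e < t) disjoint edge sets of H joining the a k.
--
-- The colour (i , j) consists of the j-th layer, a copy of T i meeting each copy of H once, and of
-- the edges from each terminal to the vertex of that layer over one T i-neighbour of u k (its port).
-- The colour e consists of the copies of B e over all vertices of G, and of a copy of a bipartite
-- part of T i₀ that alternates between two different layers, so that it uses no edge of a layer.
-- The layers are permuted over each u k so that this alternating copy passes through the
-- B e-component of a k.  If u 0 ≡ u 1 ≢ u 2, then B e must be met outside a 0 and a 1, in distinct
-- vertices for distinct e: neighbours of a 0, or neighbours of a 1, do.  Sharpness is seen on the
-- path with three vertices and the edgeless graph, where the degree of (0 , 0) is an upper bound.

module Submission where

open import Defs
open import Data.Bool.Base using (Bool; true; false; not)
import Data.Bool.Properties as Bool
open import Data.Empty using (⊥-elim) renaming (⊥ to Empty)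
open import Data.Fin.Base using (Fin; zero; suc; combine; remQuot; fromℕ<; inject≤; inject₁)
open import Data.Fin.Permutation.Components using (transpose; transpose-inverse)
open import Data.Fin.Properties
  using (_≟_; any?; all?; injective⇒≤; inject≤-injective; inject₁-injective; suc-injective;
         +↔⊎; *↔×; remQuot-combine; combine-remQuot)
open import Data.Fin.Subset using (Subset; inside; outside; _∈_; _⊆_; ∣_∣; ⊤; ⊥; ⁅_⁆; _∪_)
open import Data.Fin.Subset.Properties using (_∈?_; ∣⊤∣≡n; ∈⊤; ∣⊥∣≡0; ∪-identityˡ; x∈p∪q⁺; x∈⁅x⁆)
open import Data.List.Base as List using (List; []; _∷_; _∷ʳ_; length; filter; cartesianProduct)
import Data.List.Membership.DecPropositional as DecMembership
open import Data.List.Membership.Propositional using (lose) renaming (_∈_ to _∈ˡ_)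
open import Data.List.Membership.Propositional.Properties
  using (∈-filter⁺; ∈-filter⁻; ∈-cartesianProduct⁺; ∈-allFin)
open import Data.List.Properties using (filter-notAll)
open import Data.List.Relation.Unary.All as All using (All; []; _∷_)
open import Data.List.Relation.Unary.AllPairs using ([]; _∷_)
open import Data.List.Relation.Unary.Linked as Linked using (Linked; _∷_)
open import Data.Nat.Base using (ℕ; zero; suc; _+_; _*_; _≤_; _<_; _≥_; z≤n; s≤s; s≤s⁻¹)
import Data.Nat.Properties as ℕ
open import Data.Product.Base using (_×_; _,_; Σ-syntax; ∃-syntax; ∃; proj₁; proj₂)
open import Data.Product.Properties using (≡-dec)
open import Data.Sum.Base as Sum using (_⊎_; inj₁; inj₂)
open import Data.Sum.Function.Propositional using (_⊎-↔_)
open import Data.Vec.Base as Vec using (Vec; []; _∷_; lookup; tabulate; here; there)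
import Data.Vec.Functional as Vector
open import Data.Vec.Properties using (lookup∘tabulate; []=⇒lookup; lookup⇒[]=; lookup-map)
open import Function.Base using (_∘_; id; case_of_)
open import Function.Bundles using (Injection)
open import Function.Construct.Composition using (_↔-∘_)
open import Function.Construct.Identity using (↔-id)
open import Function.Definitions using (Injective)
open import Function.Properties.Inverse using (↔⇒↣)
open import Level using (0ℓ)
open import Relation.Binary.Construct.Closure.ReflexiveTransitive as Star
  using (Star; ε; _◅_; _◅◅_; _⋆)
open import Relation.Binary.Core using (Rel; _⇒_)
open import Relation.Binary.Definitions using (Symmetric; Decidable)
open import Relation.Binary.PropositionalEquality
  using (_≡_; _≢_; refl; sym; trans; cong; cong₂; subst; subst₂; _≗_)
open import Relation.Nullary.Decidable
  using (Dec; yes; no; does; dec-true; dec-false; map′; decidable-stable; ¬?; _×-dec_; _⊎-dec_)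
open import Relation.Nullary.Negation using (¬_; contradiction)
import Relation.Unary as U

private
  variable
    n m k ℓ t : ℕ

-- Decidable subsets and walks.

subset : {P : Fin n → Set} → U.Decidable P → Subset n
subset P? = tabulate (does ∘ P?)

module _ {P : Fin n → Set} (P? : U.Decidable P) where

  ∈-subset⁺ : ∀ {x} → P x → x ∈ subset P?
  ∈-subset⁺ {x} p =
    lookup⇒[]= x _ (trans (lookup∘tabulate (does ∘ P?) x) (dec-true (P? x) p))

  ∈-subset⁻ : ∀ {x} → x ∈ subset P? → P x
  ∈-subset⁻ {x} x∈ with P? x | trans (sym (lookup∘tabulate (does ∘ P?) x)) ([]=⇒lookup x∈)
  ... | yes p | _ = p

module _ {V : Set} {E : Rel V 0ℓ} where

  firstStep : ∀ {x y} → x ≢ y → Star E x y → ∃ (E x)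
  firstStep x≢y ε       = contradiction refl x≢y
  firstStep _   (e ◅ _) = _ , e

-- Spanning forests by deletion of cycle edges.

Acyclic : Rel (Fin n) 0ℓ → Set
Acyclic E = ∀ x xs → ¬ IsCycle E x xs

module _ {n : ℕ} where

  -- Edge sets are kept as finite lists because the length of a list drops with every deletion.
  Listed : List (Fin n × Fin n) → Rel (Fin n) 0ℓ
  Listed L x y = (x , y) ∈ˡ L

  listed? : ∀ L → Decidable (Listed L)
  listed? L x y = (x , y) ∈ˡ? L
    where open DecMembership {A = Fin n × Fin n} (≡-dec _≟_ _≟_) using () renaming (_∈?_ to _∈ˡ?_)

  module Removal (x y : Fin n) where

    Kept : Fin n × Fin n → Set
    Kept (p , q) = ¬ ((p ≡ x × q ≡ y) ⊎ (p ≡ y × q ≡ x))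

    kept? : U.Decidable Kept
    kept? (p , q) = ¬? ((p ≟ x ×-dec q ≟ y) ⊎-dec (p ≟ y ×-dec q ≟ x))

    remove : List (Fin n × Fin n) → List (Fin n × Fin n)
    remove = filter kept?

    -- Every link starts at a vertex other than `x` and `y`, so none is the deleted edge in either
    -- direction, not even the last link, which ends at `x`.
    detour : ∀ L v vs → All (λ w → w ≢ x × w ≢ y) (v ∷ vs) →
             Linked (Listed L) (v ∷ vs ∷ʳ x) → Star (Listed (remove L)) v x
    detour L v [] ((v≢x , v≢y) ∷ []) (e ∷ _) =
      ∈-filter⁺ kept? e (λ { (inj₁ (p , _)) → v≢x p ; (inj₂ (p , _)) → v≢y p }) ◅ ε
    detour L v (w ∷ vs) ((v≢x , v≢y) ∷ ps) (e ∷ es) =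
      ∈-filter⁺ kept? e (λ { (inj₁ (p , _)) → v≢x p ; (inj₂ (p , _)) → v≢y p })
      ◅ detour L w vs ps es

    remove-sym : ∀ {L} → Symmetric (Listed L) → Symmetric (Listed (remove L))
    remove-sym s e = let e∈ , kept = ∈-filter⁻ kept? e in
      ∈-filter⁺ kept? (s e∈)
        λ { (inj₁ (p , q)) → kept (inj₂ (q , p)) ; (inj₂ (p , q)) → kept (inj₁ (q , p)) }

  open Removal using (remove; kept?; detour; remove-sym)

  -- The rest of the cycle, from `y` round to `x`, replaces the deleted edge; reversing it serves
  -- the other orientation.
  removeCycleEdge : ∀ L → Symmetric (Listed L) → ∀ x y ys → IsCycle (Listed L) x (y ∷ ys) →
                    Listed L ⇒ Star (Listed (remove x y L))
  removeCycleEdge L s x y [] cyc = contradiction (IsCycle.long cyc) λ { (s≤s (s≤s ())) }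
  removeCycleEdge L s x y (z ∷ zs) cyc {p} {q} e with kept? x y (p , q)
  ... | yes kept = ∈-filter⁺ (kept? x y) e kept ◅ ε
  ... | no ¬kept with (x≢y ∷ x≢zs) ∷ (y≢zs ∷ _) ← IsCycle.distinct cyc
                    | _ ∷ (yz ∷ links) ← IsCycle.closed cyc
    = reorient (toSum ¬kept)
    where
    toSum : ¬ ¬ ((p ≡ x × q ≡ y) ⊎ (p ≡ y × q ≡ x)) → (p ≡ x × q ≡ y) ⊎ (p ≡ y × q ≡ x)
    toSum = decidable-stable ((p ≟ x ×-dec q ≟ y) ⊎-dec (p ≟ y ×-dec q ≟ x))
    yx : Star (Listed (remove x y L)) y x
    yx = ∈-filter⁺ (kept? x y) yz
           (λ { (inj₁ (p , _)) → x≢y (sym p) ; (inj₂ (_ , p)) → All.head x≢zs (sym p) })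
         ◅ detour x y L z zs
             (All.zipWith (λ { (a , b) → (a ∘ sym) , (b ∘ sym) }) (x≢zs , y≢zs)) links
    reorient : (p ≡ x × q ≡ y) ⊎ (p ≡ y × q ≡ x) → Star (Listed (remove x y L)) p q
    reorient (inj₁ (refl , refl)) = Star.reverse (remove-sym x y s) yx
    reorient (inj₂ (refl , refl)) = yx

  removed : ∀ L x y ys → IsCycle (Listed L) x (y ∷ ys) → length (remove x y L) < length L
  removed L x y ys cyc with xy ∷ _ ← IsCycle.closed cyc =
    filter-notAll (kept? x y) L (lose xy λ kept → kept (inj₁ (refl , refl)))

  -- As long as a cycle exists, its first edge is deleted, which keeps the ends of every edge
  -- joined. `fuel` bounds the length of the list and hence the number of deletions.
  forest : ∀ fuel L → length L ≤ fuel → Symmetric (Listed L) →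
           ∃[ L′ ] (Symmetric (Listed L′) × Acyclic (Listed L′)
                   × Listed L′ ⇒ Listed L × Listed L ⇒ Star (Listed L′))
  forest fuel L bound s with hasCycle? (listed? L)
  ... | no ¬c = L , s , (λ x xs c → ¬c (x , xs , c)) , id , Star.return
  ... | yes (x , [] , cyc) = contradiction (IsCycle.long cyc) λ { (s≤s ()) }
  forest zero L bound s | yes (x , y ∷ ys , cyc) =
    contradiction (ℕ.≤-trans (removed L x y ys cyc) bound) λ ()
  forest (suc fuel) L bound s | yes (x , y ∷ ys , cyc) =
    let L′ , s′ , acyc , sub , conn =
          forest fuel (remove x y L) (s≤s⁻¹ (ℕ.≤-trans (removed L x y ys cyc) bound)) (remove-sym x y s)
    in L′ , s′ , acyc , proj₁ ∘ ∈-filter⁻ (kept? x y) ∘ sub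
     , (conn ⋆) ∘ removeCycleEdge L s x y ys cyc

-- Steiner trees inside a given edge set.

module _ (G : Graph n) {E : Rel (Fin n) 0ℓ} (E? : Decidable E) (E-sym : Symmetric E)
         (E⇒adj : E ⇒ Adj G) (S : Subset n) {r : Fin n} (r∈ : r ∈ S)
         (joined : ∀ {x y} → x ∈ S → y ∈ S → Star E x y) where

  private
    pairs : List (Fin n × Fin n)
    pairs = cartesianProduct (List.allFin n) (List.allFin n)

    edges : List (Fin n × Fin n)
    edges = filter (λ (x , y) → E? x y) pairs

    edges⁺ : E ⇒ Listed edges
    edges⁺ = ∈-filter⁺ (λ (x , y) → E? x y) (∈-cartesianProduct⁺ (∈-allFin _) (∈-allFin _))

    edges⁻ : Listed edges ⇒ E
    edges⁻ e = proj₂ (∈-filter⁻ (λ (x , y) → E? x y) {xs = pairs} e)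

    edges-sym : Symmetric (Listed edges)
    edges-sym e = edges⁺ (E-sym (edges⁻ e))

  -- The tree is the component of `r` in a spanning forest of `E`: vertices and neighbourhoods are
  -- restricted to what `r` reaches. `S` lies inside because the forest keeps its vertices joined to
  -- `r`.
  spanningTree : Σ[ T ∈ Subgraph G ] (IsSteinerTree S T × Edge T ⇒ E)
  spanningTree with forest _ edges ℕ.≤-refl edges-sym
  ... | L , L-sym , acyc , sub , conn = T
      , ( (λ x∈ → ∈-subset⁺ from? (joined′ r∈ x∈))
        , record
            { nonempty  = r , ∈-subset⁺ from? ε
            ; connected = λ x∈ y∈ → let rx = ∈-subset⁻ from? x∈ ; ry = ∈-subset⁻ from? y∈
                                    in lift rx (Star.reverse L-sym rx ◅◅ ry)
            ; acyclic   = λ x xs c → acyc x xs record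
                { long = IsCycle.long c ; distinct = IsCycle.distinct c
                ; closed = Linked.map (λ e → proj₂ (N⁻ e)) (IsCycle.closed c) } })
      , λ e → edges⁻ (sub (proj₂ (N⁻ e)))
    where
    from? : U.Decidable (Star (Listed L) r)
    from? = star? (listed? L) r

    joined′ : ∀ {x y} → x ∈ S → y ∈ S → Star (Listed L) x y
    joined′ x∈ y∈ = ((λ e → conn (edges⁺ e)) ⋆) (joined x∈ y∈)

    nbr? : ∀ x → U.Decidable (λ y → Star (Listed L) r x × Listed L x y)
    nbr? x y = from? x ×-dec listed? L x y

    N : Vec (Subset n) n
    N = tabulate λ x → subset (nbr? x)

    N⁺ : ∀ {x y} → Star (Listed L) r x → Listed L x y → y ∈ lookup N x
    N⁺ {x} {y} rx e =
      subst (y ∈_) (sym (lookup∘tabulate (subset ∘ nbr?) x)) (∈-subset⁺ (nbr? x) (rx , e))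

    N⁻ : ∀ {x y} → y ∈ lookup N x → Star (Listed L) r x × Listed L x y
    N⁻ {x} {y} e = ∈-subset⁻ (nbr? x) (subst (y ∈_) (lookup∘tabulate (subset ∘ nbr?) x) e)

    lift : ∀ {x y} → Star (Listed L) r x → Star (Listed L) x y →
           Star (λ p q → q ∈ lookup N p) x y
    lift rx ε        = ε
    lift rx (e ◅ es) = N⁺ rx e ◅ lift (rx ◅◅ (e ◅ ε)) es

    T : Subgraph G
    T = record
      { verts     = subset from?
      ; nbrs      = N
      ; edge-symm = λ e → let rx , xy = N⁻ e in N⁺ (rx ◅◅ (xy ◅ ε)) (L-sym xy)
      ; edge⇒adj  = λ e → E⇒adj (edges⁻ (sub (proj₂ (N⁻ e))))
      ; edge⇒vert = λ e → ∈-subset⁺ from? (proj₁ (N⁻ e))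
      }

-- Enumerating and covering finite sets.

enumerate : (S : Subset n) → Σ[ f ∈ (Fin ∣ S ∣ → Fin n) ]
            (Injective _≡_ _≡_ f × (∀ i → f i ∈ S) × (∀ {x} → x ∈ S → ∃[ i ] f i ≡ x))
enumerate []            = (λ ()) , (λ { {()} }) , (λ ()) , λ ()
enumerate (outside ∷ S) = let f , inj , mem , onto = enumerate S in
  suc ∘ f , inj ∘ suc-injective , there ∘ mem
  , λ { (there x∈) → let i , eq = onto x∈ in i , cong suc eq }
enumerate (inside  ∷ S) = let f , inj , mem , onto = enumerate S in
  (λ { zero → zero ; (suc i) → suc (f i) })
  , (λ { {zero} {zero} _ → refl ; {suc i} {suc j} eq → cong suc (inj (suc-injective eq)) })
  , (λ { zero → here ; (suc i) → there (mem i) })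
  , λ { here → zero , refl ; (there x∈) → let i , eq = onto x∈ in suc i , cong suc eq }

∣⁅x⁆∪p∣≤1+∣p∣ : ∀ x (S : Subset n) → ∣ ⁅ x ⁆ ∪ S ∣ ≤ suc ∣ S ∣
∣⁅x⁆∪p∣≤1+∣p∣ zero (s ∷ S) rewrite ∪-identityˡ S with s
... | inside  = ℕ.n≤1+n _
... | outside = ℕ.≤-refl
∣⁅x⁆∪p∣≤1+∣p∣ (suc x) (inside  ∷ S) = s≤s (∣⁅x⁆∪p∣≤1+∣p∣ x S)
∣⁅x⁆∪p∣≤1+∣p∣ (suc x) (outside ∷ S) = ∣⁅x⁆∪p∣≤1+∣p∣ x S

superset : (S : Subset n) → ∣ S ∣ ≤ k → k ≤ n → ∃[ S′ ] ∣ S′ ∣ ≡ k × S ⊆ S′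
superset S S≤k k≤n with ℕ.m≤n⇒m<n∨m≡n k≤n
superset S S≤k k≤n | inj₂ refl = ⊤ , ∣⊤∣≡n _ , λ _ → ∈⊤
superset (inside ∷ S) (s≤s S≤k) k≤n | inj₁ (s≤s k<n) =
  let S′ , eq , sub = superset S S≤k (ℕ.<⇒≤ k<n) in
  inside ∷ S′ , cong suc eq , λ { here → here ; (there x∈) → there (sub x∈) }
superset (outside ∷ S) S≤k k≤n | inj₁ (s≤s k≤n′) =
  let S′ , eq , sub = superset S S≤k k≤n′ in
  outside ∷ S′ , eq , λ { (there x∈) → there (sub x∈) }

cover : (p : Fin k → Fin n) → ∃[ S ] ∣ S ∣ ≤ k × (∀ i → p i ∈ S)
cover {zero}  {n} p = ⊥ , ℕ.≤-reflexive (∣⊥∣≡0 n) , λ ()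
cover {suc k} {n} p =
  let S , ∣S∣≤k , mem = cover (p ∘ suc) in
  ⁅ p zero ⁆ ∪ S , ℕ.≤-trans (∣⁅x⁆∪p∣≤1+∣p∣ (p zero) S) (s≤s ∣S∣≤k)
  , λ { zero → x∈p∪q⁺ (inj₁ (x∈⁅x⁆ _)) ; (suc i) → x∈p∪q⁺ {p = ⁅ p zero ⁆} (inj₂ (mem i)) }

-- Meant for the coordinates of three vertices of a product: these may coincide, so the set of their
-- values is padded to size `k`.
coverOfSize : k ≤ n → (p : Fin k → Fin n) → ∃[ S ] ∣ S ∣ ≡ k × (∀ i → p i ∈ S)
coverOfSize k≤n p =
  let S , ∣S∣≤k , mem = cover p
      S′ , eq , sub = superset S ∣S∣≤k k≤n
  in S′ , eq , λ i → sub (mem i)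

-- If all elements were `a` or `b`, then `h`, which records whether an element is `a`, would inject
-- a set of size three into `Fin 2`. This includes the case `a ≡ b`.
thirdElement : (S : Subset n) → ∣ S ∣ ≡ 3 → ∀ a b → ∃[ z ] z ∈ S × z ≢ a × z ≢ b
thirdElement S eq a b
  with any? (λ z → (z ∈? S) ×-dec ¬? (z ≟ a) ×-dec ¬? (z ≟ b))
... | yes p = p
... | no ¬p = contradiction (injective⇒≤ {f = h} h-inj) λ S≤2 →
    ℕ.1+n≰n (ℕ.≤-trans (ℕ.≤-reflexive (sym eq)) S≤2)
  where
  f : Fin ∣ S ∣ → _
  f = proj₁ (enumerate S)
  h : Fin ∣ S ∣ → Fin 2
  h i with f i ≟ a
  ... | yes _ = zero
  ... | no  _ = suc zero
  b-only : ∀ i → f i ≢ a → f i ≡ b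
  b-only i ≢a with f i ≟ b
  ... | yes ≡b = ≡b
  ... | no  ≢b = contradiction (f i , proj₁ (proj₂ (proj₂ (enumerate S))) i , ≢a , ≢b) ¬p
  h-inj : Injective _≡_ _≡_ h
  h-inj {i} {j} eq with f i ≟ a | f j ≟ a
  ... | yes p | yes q = proj₁ (proj₂ (enumerate S)) (trans p (sym q))
  ... | no p  | no q  = proj₁ (proj₂ (enumerate S)) (trans (b-only i p) (sym (b-only j q)))

-- Generalized 3-edge-connectivity in terms of packings.

λ₃-packing : (G : Graph n) → 3 ≤ n → ∀ {S} → ∣ S ∣ ≡ 3 → Packing G S (λ[ 3 ] G)
λ₃-packing G 3≤n {S} eq with λ-spec G (s≤s (s≤s z≤n)) 3≤n
... | inj₂ (_ , λ≡0) = subst (Packing G S) (sym λ≡0) (empty G S)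
... | inj₁ (_ , _ , least) with b , local ← localλ-exists G S (subst (2 ≤_) (sym eq) (s≤s (s≤s z≤n))) =
  -- The minimum is at most the local value of `S`, so the first trees of a maximum packing suffice.
  let λ≤b = least b (S , eq , local)
      open Packing (proj₁ local)
  in record
    { tree     = λ i → tree (inject≤ i λ≤b)
    ; steiner  = λ i → steiner (inject≤ i λ≤b)
    ; disjoint = λ i j i≢j → disjoint _ _ (i≢j ∘ inject≤-injective λ≤b λ≤b i j)
    }

-- Connectivity excludes the conventional value 0, so the minimum is attained at some `S`, and no
-- packing for that `S` exceeds it.
λ₃-greatest : (G : Graph n) → 3 ≤ n → Connected G →
              (∀ S → ∣ S ∣ ≡ 3 → Packing G S t) → t ≤ λ[ 3 ] G
λ₃-greatest G 3≤n conn packings with λ-spec G (s≤s (s≤s z≤n)) 3≤n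
... | inj₂ (¬conn , _)                           = contradiction conn ¬conn
... | inj₁ (_ , (S , eq , _ , max) , _) = max _ (packings S eq)

-- Extension of injections, two-colourings and walks.

extendInjection : (g f : Fin k → Fin n) → Injective _≡_ _≡_ g → Injective _≡_ _≡_ f →
                  Σ[ φ ∈ (Fin n → Fin n) ] (Injective _≡_ _≡_ φ × φ ∘ g ≗ f)
extendInjection {zero} g f g-inj f-inj = id , id , λ ()
extendInjection {suc k} {n} g f g-inj f-inj
  with φ , φ-inj , agree ← extendInjection (g ∘ suc) (f ∘ suc)
                             (suc-injective ∘ g-inj) (suc-injective ∘ f-inj) =
  -- The transposition `σ` corrects the value at `g zero`. The values already right stay fixed,
  -- since by injectivity they differ from both transposed points.
  σ ∘ φ , φ-inj ∘ σ-inj , λ { zero → σ-i (φ (g zero)) (f zero) ; (suc i) →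
    trans (σ-fix (φ (g (suc i)))
             (λ eq → contradiction (g-inj (φ-inj eq)) λ ())
             (λ eq → contradiction (f-inj (trans (sym (agree i)) eq)) λ ())) (agree i) }
  where
  σ : Fin n → Fin n
  σ = transpose (φ (g zero)) (f zero)
  σ-inj : Injective _≡_ _≡_ σ
  σ-inj eq = trans (sym (transpose-inverse _ _))
    (trans (cong (transpose (f zero) (φ (g zero))) eq) (transpose-inverse _ _))
  σ-i : ∀ i j → transpose i j i ≡ j
  σ-i i j rewrite dec-true (i ≟ i) refl = refl
  σ-fix : ∀ x → x ≢ φ (g zero) → x ≢ f zero → σ x ≡ x
  σ-fix x p q rewrite dec-false (x ≟ φ (g zero)) p | dec-false (x ≟ f zero) q = refl

-- The two-colouring by the parity of the distance to r keeps every geodesic to r.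

module _ {E : Rel (Fin n) 0ℓ} (E? : Decidable E) (r : Fin n) where

  private
    Walk : ℕ → Fin n → Set
    Walk zero    x = x ≡ r
    Walk (suc k) x = ∃[ y ] E x y × Walk k y

    walk? : ∀ x → U.Decidable (λ k → Walk k x)
    walk? x zero    = x ≟ r
    walk? x (suc k) = any? λ y → E? x y ×-dec walk? y k

    fromStar : ∀ {x} → Star E x r → ∃[ k ] Walk k x
    fromStar ε        = 0 , refl
    fromStar (e ◅ es) = let k , w = fromStar es in suc k , _ , e , w

    toStar : ∀ k {x} → Walk k x → Star E x r
    toStar zero    refl        = ε
    toStar (suc k) (_ , e , w) = e ◅ toStar k w

    distance : ∀ {x} → Star E x r → ∃ (IsMinimum λ k → Walk k x)
    distance {x} s = minimum (walk? x) (proj₂ (fromStar s))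

    odd : ℕ → Bool
    odd zero    = false
    odd (suc k) = not (odd k)

    parity : Fin n → Bool
    parity x with star? E? x r
    ... | yes s = odd (proj₁ (distance s))
    -- Vertices without a walk to `r` lie on no geodesic to it, so any value serves.
    ... | no _  = false

    parity-minimum : ∀ {x k} → IsMinimum (λ k → Walk k x) k → parity x ≡ odd k
    parity-minimum {x} {k} (w , least) with star? E? x r
    ... | no ¬s = contradiction (toStar k w) ¬s
    ... | yes s = let d , w′ , least′ = distance s in
      cong odd (ℕ.≤-antisym (least′ k w) (least d w′))

    geodesic : ∀ k {x} → IsMinimum (λ k → Walk k x) k →
               Star (λ p q → E p q × parity p ≢ parity q) x r
    geodesic zero    (refl , _)              = ε
    geodesic (suc k) {x} min@((y , e , w) , least) =
      (e , λ eq → Bool.not-¬ (trans eq (parity-minimum min-y)) (parity-minimum min))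
      ◅ geodesic k min-y
      where
      min-y : IsMinimum (λ k → Walk k y) k
      min-y = w , λ b w′ → s≤s⁻¹ (least (suc b) (y , e , w′))

  bipartite : Σ[ parity ∈ (Fin n → Bool) ] (parity r ≡ false ×
              (∀ {x} → Star E x r → Star (λ p q → E p q × parity p ≢ parity q) x r))
  bipartite = parity , parity-minimum (refl , λ _ _ → z≤n)
            , λ s → geodesic _ (proj₂ (distance s))

-- The walk from `a` to `z` has a first step out of `{a , b}`; the two cases tell at which of the
-- two vertices it starts.
escape : {E : Rel (Fin n) 0ℓ} → ∀ a b {z} → z ≢ a → z ≢ b → Star E a z →
         (∃[ y ] y ≢ b × E a y) ⊎ (∃[ y ] y ≢ a × E b y)
escape {E = E} a b {z} z≢a z≢b = go (inj₁ refl)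
  where
  go : ∀ {x} → x ≡ a ⊎ x ≡ b → Star E x z →
       (∃[ y ] y ≢ b × E a y) ⊎ (∃[ y ] y ≢ a × E b y)
  go (inj₁ z≡a) ε = contradiction z≡a z≢a
  go (inj₂ z≡b) ε = contradiction z≡b z≢b
  go x∈ (_◅_ {j = y} e es) with y ≟ a | y ≟ b
  ... | yes y≡a | _       = go (inj₁ y≡a) es
  ... | _       | yes y≡b = go (inj₂ y≡b) es
  go (inj₁ refl) (e ◅ es) | no _   | no y≢b = inj₁ (_ , y≢b , e)
  go (inj₂ refl) (e ◅ es) | no y≢a | no _   = inj₂ (_ , y≢a , e)

-- Families of disjoint edge sets.

-- Plain edge sets instead of trees, so that colour classes can be described without regard to
-- cycles; `E-unique` is their disjointness.
record Family (G : Graph n) (I : Set) : Set₁ where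
  field
    E        : I → Rel (Fin n) 0ℓ
    E?       : ∀ i → Decidable (E i)
    E-sym    : ∀ i → Symmetric (E i)
    E⇒adj    : ∀ i → E i ⇒ Adj G
    E-unique : ∀ {i j x y} → E i x y → E j x y → i ≡ j

  E-irrefl : ∀ i {x y} → E i x y → x ≢ y
  E-irrefl i e x≡y = irrefl G x≡y (E⇒adj i e)

Joins : {G : Graph n} {I : Set} → Family G I → Subset n → Set
Joins F S = ∀ i {x y} → x ∈ S → y ∈ S → Star (Family.E F i) x y

fromPacking : {G : Graph n} {S : Subset n} → Packing G S t → Σ[ F ∈ Family G (Fin t) ] Joins F S
fromPacking P = record
  { E        = λ i → Edge (tree i)
  ; E?       = λ i x y → y ∈? lookup (nbrs (tree i)) x
  ; E-sym    = λ i → edge-symm (tree i)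
  ; E⇒adj    = λ i → edge⇒adj (tree i)
  ; E-unique = λ {i} {j} e e′ → case i ≟ j of λ where
      (yes i≡j) → i≡j
      (no  i≢j) → contradiction (e , e′) (disjoint i j i≢j _ _)
  } , λ i x∈ y∈ → IsTree.connected (proj₂ (steiner i)) (proj₁ (steiner i) x∈) (proj₁ (steiner i) y∈)
  where open Packing P

toPacking : {G : Graph n} {S : Subset n} {I : Set} (F : Family G I) → Joins F S →
            ∀ {r} → r ∈ S → (f : Fin t → I) → Injective _≡_ _≡_ f → Packing G S t
toPacking {G = G} {S} F joins r∈ f f-inj = record
  { tree     = proj₁ ∘ T
  ; steiner  = λ i → proj₁ (proj₂ (T i))
  ; disjoint = λ i j i≢j x y (e , e′) →
      i≢j (f-inj (E-unique (proj₂ (proj₂ (T i)) e) (proj₂ (proj₂ (T j)) e′)))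
  }
  where
  open Family F
  T : ∀ i → Σ[ T ∈ Subgraph G ] (IsSteinerTree S T × Edge T ⇒ E (f i))
  T i = spanningTree G (E? (f i)) (E-sym (f i)) (E⇒adj (f i)) S r∈ (joins (f i))

module _ {G : Graph n} (F : Family G (Fin t)) where

  open Family F

  Representatives : Fin n → Fin n → Set
  Representatives a b = Σ[ y ∈ (Fin t → Fin n) ]
    (Injective _≡_ _≡_ y × (∀ e → y e ≢ a × y e ≢ b) × (∀ e → E e a (y e)))

  -- Only one of the disjoint subgraphs contains the edge ab.  If a has a neighbour other than b in
  -- each of them, use those; otherwise ab lies in a subgraph that leaves {a , b} through b, and b
  -- has a neighbour other than a in each of them.

  representatives : ∀ {a b z} → a ≢ b → z ≢ a → z ≢ b →
                    (∀ e → Star (E e) a z) → (∀ e → Star (E e) b a) →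
                    Representatives a b ⊎ Representatives b a
  representatives {a} {b} a≢b z≢a z≢b az ba
    with all? (λ e → any? λ y → ¬? (y ≟ b) ×-dec E? e a y)
  ... | yes p = inj₁ (proj₁ ∘ p , (λ {e} {e′} eq → E-unique (proj₂ (proj₂ (p e)))
          (subst (E e′ a) (sym eq) (proj₂ (proj₂ (p e′)))))
        , (λ e → (E-irrefl e (proj₂ (proj₂ (p e))) ∘ sym) , proj₁ (proj₂ (p e)))
        , λ e → proj₂ (proj₂ (p e)))
  ... | no ¬p = inj₂ (proj₁ ∘ p , (λ {e} {e′} eq → E-unique (proj₂ (proj₂ (p e)))
          (subst (E e′ b) (sym eq) (proj₂ (proj₂ (p e′)))))
        , (λ e → (E-irrefl e (proj₂ (proj₂ (p e))) ∘ sym) , proj₁ (proj₂ (p e)))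
        , λ e → proj₂ (proj₂ (p e)))
    where
    p : ∀ e → ∃[ y ] y ≢ a × E e b y
    p e with escape a b z≢a z≢b (az e) | firstStep (a≢b ∘ sym) (ba e)
    ... | inj₂ q | _ = q
    ... | inj₁ q | y , by with y ≟ a
    ...   | no y≢a = y , y≢a , by
    -- Here `e` contains `ab` and yet gives `a` a neighbour other than `b`. Every other subgraph
    -- lacks `ab`, so it does the same, against `¬p`.
    ...   | yes refl = contradiction others ¬p
      where
      others : ∀ e′ → ∃[ y ] y ≢ b × E e′ a y
      others e′ with e′ ≟ e
      ... | yes refl = q
      ... | no e′≢e with firstStep a≢b (Star.reverse (E-sym e′) (ba e′))
      ...   | y , ay = y , (λ { refl → e′≢e (E-unique ay (E-sym e by)) }) , ay

-- The edge colouring of the lexicographic product.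

Covers : (Fin 3 → Fin n × Fin m) → Subset (n * m) → Set
Covers {m = m} p S = ∀ {x} → x ∈ S → ∃[ k ] remQuot m x ≡ p k

-- `φ w` turns labels into vertices of the copy of `H` over `w`: terminal `k` has label `s k`, layer
-- `j` has label `j` everywhere, and the `e`-th alternating copy has label `τ w e` over `w`. `τ-inj`
-- keeps the alternating copies apart from each other, `τ-proper` from the layers, and `τ-avoids`
-- from the edges between terminals and ports.
module Colouring
  {G : Graph n} {H : Graph m} (𝓣 : Family G (Fin ℓ)) (𝓑 : Family H (Fin t))
  (u : Fin 3 → Fin n) (s : Fin 3 → Fin m) (port : Fin ℓ → Fin 3 → Fin n)
  (port-edge : ∀ i k → Family.E 𝓣 i (u k) (port i k))
  (port-facing : ∀ i k k′ → port i k ≡ u k′ → port i k′ ≡ u k → s k ≡ s k′)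
  (φ : Fin n → Fin m → Fin m) (φ-inj : ∀ w → Injective _≡_ _≡_ (φ w))
  (i₀ : Fin ℓ) {F : Rel (Fin n) 0ℓ} (F? : Decidable F) (F-sym : Symmetric F) (F⇒T : F ⇒ Family.E 𝓣 i₀)
  (τ : Fin n → Fin t → Fin m)
  (τ-inj : ∀ {w w′} → F w w′ → Injective _≡_ _≡_ (τ w))
  (τ-proper : ∀ {w w′} → F w w′ → ∀ e → τ w e ≢ τ w′ e)
  (τ-avoids : ∀ {k w} → F (u k) w → ∀ e → τ (u k) e ≢ s k)
  where

  private
    module T = Family 𝓣
    module B = Family 𝓑
    open T using () renaming (E to T)

    V : Set
    V = Fin n × Fin m

  terminal : Fin 3 → V
  terminal k = u k , φ (u k) (s k)

  Port : Fin ℓ → V → Fin n → Set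
  Port i x w = ∃[ k ] x ≡ terminal k × w ≡ port i k

  Near : Fin ℓ → Fin m → V → Fin n → Set
  Near i j x w = proj₂ x ≡ φ (proj₁ x) j ⊎ Port i x w

  -- An edge of colour `(i , j)` has one end in layer `j`; the other end is in that layer too, or is
  -- a terminal whose port lies under the first end. `layer` and `layer′` are the two orientations.
  data Colour : Fin t ⊎ (Fin ℓ × Fin m) → Rel V 0ℓ where
    layer : ∀ {i j w p w′ p′} → T i w w′ → Near i j (w , p) w′ → p′ ≡ φ w′ j →
            Colour (inj₂ (i , j)) (w , p) (w′ , p′)
    layer′ : ∀ {i j w p w′ p′} → T i w w′ → p ≡ φ w j → Near i j (w′ , p′) w →
            Colour (inj₂ (i , j)) (w , p) (w′ , p′)
    twist : ∀ {e w p w′ p′} → F w w′ → p ≡ φ w (τ w e) → p′ ≡ φ w′ (τ w′ e) →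
            Colour (inj₁ e) (w , p) (w′ , p′)
    copy  : ∀ {e w p p′} → B.E e p p′ → Colour (inj₁ e) (w , p) (w , p′)

  port? : ∀ i x w → Dec (Port i x w)
  port? i x w = any? λ k → ≡-dec _≟_ _≟_ x (terminal k) ×-dec (w ≟ port i k)

  near? : ∀ i j x w → Dec (Near i j x w)
  near? i j x w = proj₂ x ≟ φ (proj₁ x) j ⊎-dec port? i x w

  colour? : ∀ c → Decidable (Colour c)
  colour? (inj₂ (i , j)) (w , p) (w′ , p′) =
    map′ (λ { (e , inj₁ (a , b)) → layer e a b ; (e , inj₂ (a , b)) → layer′ e a b })
         (λ { (layer e a b) → e , inj₁ (a , b) ; (layer′ e a b) → e , inj₂ (a , b) })
      (T.E? i w w′ ×-dec ((near? i j _ _ ×-dec (p′ ≟ φ w′ j)) ⊎-dec ((p ≟ φ w j) ×-dec near? i j _ _)))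
  colour? (inj₁ e) (w , p) (w′ , p′) =
    map′ (λ { (inj₁ (f , a , b)) → twist f a b ; (inj₂ (refl , b)) → copy b })
         (λ { (twist f a b) → inj₁ (f , a , b) ; (copy b) → inj₂ (refl , b) })
      ((F? w w′ ×-dec ((p ≟ φ w (τ w e)) ×-dec (p′ ≟ φ w′ (τ w′ e))))
        ⊎-dec ((w ≟ w′) ×-dec B.E? e p p′))

  colour-sym : ∀ c → Symmetric (Colour c)
  colour-sym _ (layer e a b)  = layer′ (T.E-sym _ e) b a
  colour-sym _ (layer′ e a b) = layer (T.E-sym _ e) b a
  colour-sym _ (twist f a b)  = twist (F-sym f) b a
  colour-sym _ (copy b)       = copy (B.E-sym _ b)

  colour⇒adj : ∀ c → Colour c ⇒ LexAdj G H
  colour⇒adj _ (layer e _ _)  = inj₁ (T.E⇒adj _ e)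
  colour⇒adj _ (layer′ e _ _) = inj₁ (T.E⇒adj _ e)
  colour⇒adj _ (twist f _ _)  = inj₁ (T.E⇒adj i₀ (F⇒T f))
  colour⇒adj _ (copy b)       = inj₂ (refl , B.E⇒adj _ b)

  -- If one end carries both labels, injectivity of `φ` decides. Otherwise both ends are terminals,
  -- each over the port of the other; then `j` and `j′` are their labels, which `port-facing`
  -- equates.
  ports-agree : ∀ {i j j′ w p w′ p′} → p ≡ φ w j → Near i j (w′ , p′) w →
                Near i j′ (w , p) w′ → p′ ≡ φ w′ j′ → j ≡ j′
  ports-agree p≡ _ (inj₁ p≡′) _ = φ-inj _ (trans (sym p≡) p≡′)
  ports-agree _ (inj₁ q≡) _ q≡′ = φ-inj _ (trans (sym q≡) q≡′)
  ports-agree {i} p≡ (inj₂ (k′ , refl , w≡)) (inj₂ (k , refl , w′≡)) q≡ =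
    trans (sym (φ-inj _ p≡)) (trans (port-facing i k k′ (sym w′≡) (sym w≡)) (φ-inj _ q≡))

  same-layer : ∀ {i j j′ x y} → Colour (inj₂ (i , j)) x y → Colour (inj₂ (i , j′)) x y → j ≡ j′
  same-layer (layer _ _ q)  (layer _ _ q′)  = φ-inj _ (trans (sym q) q′)
  same-layer (layer′ _ p _) (layer′ _ p′ _) = φ-inj _ (trans (sym p) p′)
  same-layer (layer _ a q)  (layer′ _ p b)  = sym (ports-agree p b a q)
  same-layer (layer′ _ p b) (layer _ a q)   = ports-agree p b a q

  near-twist : ∀ {i j e w p w′} → Near i j (w , p) w′ → F w w′ → p ≡ φ w (τ w e) → j ≡ τ w e
  near-twist (inj₁ p≡) f p≡′ = φ-inj _ (trans (sym p≡) p≡′)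
  near-twist {e = e} (inj₂ (k , refl , _)) f p≡ =
    contradiction (sym (φ-inj _ p≡)) (τ-avoids f e)

  layer-edge : ∀ {i j x y} → Colour (inj₂ (i , j)) x y → T i (proj₁ x) (proj₁ y)
  layer-edge (layer e _ _)  = e
  layer-edge (layer′ e _ _) = e

  layer-extra : ∀ {c e x y} → Colour (inj₂ c) x y → ¬ Colour (inj₁ e) x y
  layer-extra l (copy _) = T.E-irrefl _ (layer-edge l) refl
  layer-extra {e = e} (layer _ a q) (twist f p≡ q≡) =
    τ-proper f e (trans (sym (near-twist a f p≡)) (φ-inj _ (trans (sym q) q≡)))
  layer-extra {e = e} (layer′ _ p b) (twist f p≡ q≡) =
    τ-proper f e (trans (φ-inj _ (trans (sym p≡) p)) (near-twist b (F-sym f) q≡))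

  colour-unique : ∀ {c c′ x y} → Colour c x y → Colour c′ x y → c ≡ c′
  colour-unique {inj₂ _} {inj₁ _} l x = contradiction x (layer-extra l)
  colour-unique {inj₁ _} {inj₂ _} x l = contradiction x (layer-extra l)
  colour-unique {inj₂ _} {inj₂ _} l l′ with refl ← T.E-unique (layer-edge l) (layer-edge l′) =
    cong (λ j → inj₂ (_ , j)) (same-layer l l′)
  colour-unique {inj₁ _} {inj₁ _} (copy b) (copy b′) = cong inj₁ (B.E-unique b b′)
  colour-unique {inj₁ _} {inj₁ _} (copy _) (twist f _ _) = contradiction refl (T.E-irrefl i₀ (F⇒T f))
  colour-unique {inj₁ _} {inj₁ _} (twist f _ _) (copy _) = contradiction refl (T.E-irrefl i₀ (F⇒T f))
  colour-unique {inj₁ _} {inj₁ _} (twist f p _) (twist _ p′ _) =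
    cong inj₁ (τ-inj f (φ-inj _ (trans (sym p) p′)))

  family : Family (G ∘ₗ H) (Fin t ⊎ (Fin ℓ × Fin m))
  family = record
    { E        = λ c x y → Colour c (remQuot m x) (remQuot m y)
    ; E?       = λ c x y → colour? c (remQuot m x) (remQuot m y)
    ; E-sym    = λ c → colour-sym c
    ; E⇒adj    = λ c → colour⇒adj c
    ; E-unique = colour-unique
    }

  -- The walk enters the layer at the port of `k`, returns inside it to `u k`, follows `T i` to
  -- `u k′` and on to the port of `k′`, and leaves for the terminal there.
  layers-join : (∀ i k k′ → Star (T i) (u k) (u k′)) →
                ∀ i j k k′ → Star (Colour (inj₂ (i , j))) (terminal k) (terminal k′)
  layers-join joins i j k k′ =
    toLayer k ◅ (Star.gmap (λ w → w , φ w j) (λ e → layer e (inj₁ refl) refl)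
      ((T.E-sym i (port-edge i k) ◅ joins i k k′) ◅◅ (port-edge i k′ ◅ ε))
    ◅◅ (colour-sym _ (toLayer k′) ◅ ε))
    where
    toLayer : ∀ k → Colour (inj₂ (i , j)) (terminal k) (port i k , φ (port i k) j)
    toLayer k = layer (port-edge i k) (inj₂ (k , refl , refl)) refl

  copies : ∀ {e w p p′} → Star (B.E e) p p′ → Star (Colour (inj₁ e)) (w , p) (w , p′)
  copies = Star.gmap _ copy

  twists : ∀ {e w w′} → Star F w w′ → Star (Colour (inj₁ e)) (w , φ w (τ w e)) (w′ , φ w′ (τ w′ e))
  twists {e} = Star.gmap (λ w → w , φ w (τ w e)) λ f → twist f refl refl

  packing : (∀ i k k′ → Star (T i) (u k) (u k′)) →
            (∀ e k k′ → Star (Colour (inj₁ e)) (terminal k) (terminal k′)) →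
            ∀ {S} → Covers terminal S → ∀ {r} → r ∈ S → Packing (G ∘ₗ H) S (t + ℓ * m)
  packing T-joins B-joins {S} cov r∈ =
    toPacking family joins r∈ (Injection.to f) (Injection.injective f)
    where
    f = ↔⇒↣ ((↔-id (Fin t) ⊎-↔ *↔× {ℓ} {m}) ↔-∘ +↔⊎ {t})

    colour-joins : ∀ c k k′ → Star (Colour c) (terminal k) (terminal k′)
    colour-joins (inj₁ e)       = B-joins e
    colour-joins (inj₂ (i , j)) = layers-join T-joins i j

    onFin : ∀ c {x y} → Star (Colour c) x y →
            Star (Family.E family c) (combine (proj₁ x) (proj₂ x)) (combine (proj₁ y) (proj₂ y))
    onFin c = Star.gmap _ λ {x} {y} e → subst₂ (Colour c)
      (sym (remQuot-combine (proj₁ x) (proj₂ x))) (sym (remQuot-combine (proj₁ y) (proj₂ y))) e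

    joins : Joins family S
    joins c {x} {y} x∈ y∈ = let k , x≡ = cov x∈ ; k′ , y≡ = cov y∈ in
      subst₂ (Star (Family.E family c))
        (combine-remQuot {n} m x) (combine-remQuot {n} m y)
        (onFin c (subst₂ (Star (Colour c)) (sym x≡) (sym y≡) (colour-joins c k k′)))

-- Neighbours and labels.

∷-injective : {x : Fin n} {f : Fin k → Fin n} → Injective _≡_ _≡_ f → (∀ i → f i ≢ x) →
              Injective _≡_ _≡_ (x Vector.∷ f)
∷-injective f-inj fresh {zero}  {zero}  _  = refl
∷-injective f-inj fresh {zero}  {suc j} eq = contradiction (sym eq) (fresh j)
∷-injective f-inj fresh {suc i} {zero}  eq = contradiction eq (fresh i)
∷-injective f-inj fresh {suc i} {suc j} eq = cong suc (f-inj eq)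

neighbour : {G : Graph n} {I : Set} {S : Subset n} (F : Family G I) → ∣ S ∣ ≡ 3 → Joins F S →
            ∀ i {x} → x ∈ S → ∃ (Family.E F i x)
neighbour F ∣S∣ joins i {x} x∈ = let z , z∈ , z≢x , _ = thirdElement _ ∣S∣ x x in
  firstStep (z≢x ∘ sym) (joins i x∈ z∈)

pairInjection : ∀ {a b : Fin n} {y : Fin t → Fin n} → a ≢ b → Injective _≡_ _≡_ y →
                (∀ e → y e ≢ a × y e ≢ b) → Injective _≡_ _≡_ (a Vector.∷ b Vector.∷ y)
pairInjection a≢b y-inj y≢ = ∷-injective (∷-injective y-inj (proj₂ ∘ y≢)) λ where
  zero    → a≢b ∘ sym
  (suc e) → proj₁ (y≢ e)

-- Labels `e + 2` at even and `e + 1` at odd vertices: they differ for each `e`, keep `zero` free on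
-- both sides and `suc zero` free on the even side, and overlap so that `2 + t` labels are enough.
shift : Bool → Fin t → Fin (2 + t)
shift false e = suc (suc e)
shift true  e = suc (inject₁ e)

shift-injective : ∀ b → Injective _≡_ _≡_ (shift {t} b)
shift-injective false eq = suc-injective (suc-injective eq)
shift-injective true  eq = inject₁-injective (suc-injective eq)

shift-≢0 : ∀ b (e : Fin t) → shift b e ≢ zero
shift-≢0 false e ()
shift-≢0 true  e ()

suc≢inject₁ : (e : Fin t) → suc e ≢ inject₁ e
suc≢inject₁ (suc e) eq = suc≢inject₁ e (suc-injective eq)

shift-≢ : ∀ {b b′} (e : Fin t) → b ≢ b′ → shift b e ≢ shift b′ e
shift-≢ {b = false} {false} e b≢ _  = b≢ refl
shift-≢ {b = false} {true}  e _  eq = suc≢inject₁ e (suc-injective eq)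
shift-≢ {b = true}  {false} e _  eq = suc≢inject₁ e (suc-injective (sym eq))
shift-≢ {b = true}  {true}  e b≢ _  = b≢ refl

-- Charts of the copies of `H` and alternating copies.

module _ {G : Graph n} {H : Graph m} (𝓣 : Family G (Fin ℓ)) (𝓑 : Family H (Fin t)) where

  private
    module T = Family 𝓣
    module B = Family 𝓑

  -- Under φ w ∘ lab, zero (and suc zero, if two terminals lie over w) goes to a terminal, and
  -- shift b e to the vertex where the e-th alternating copy meets the copy of H over w of parity b.

  module Spread
    (i₀ : Fin ℓ) (le : 2 + t ≤ m) (u : Fin 3 → Fin n) (a : Fin 3 → Fin m)
    (u-joins : ∀ i k k′ → Star (T.E i) (u k) (u k′))
    (σ : Fin 3 → Fin (2 + t)) (port : Fin ℓ → Fin 3 → Fin n)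
    (port-edge : ∀ i k → T.E i (u k) (port i k))
    (port-facing : ∀ i k k′ → port i k ≡ u k′ → port i k′ ≡ u k → σ k ≡ σ k′)
    (σ-avoids : ∀ b k → b ≡ proj₁ (bipartite (T.E? i₀) (u zero)) (u k) → ∀ e → shift b e ≢ σ k)
    where

    parity : Fin n → Bool
    parity = proj₁ (bipartite (T.E? i₀) (u zero))

    lab : Fin (2 + t) → Fin m
    lab i = inject≤ i le

    lab-inj : Injective _≡_ _≡_ lab
    lab-inj = inject≤-injective le le _ _

    τ : Fin n → Fin t → Fin m
    τ w e = lab (shift (parity w) e)

    Chart : Fin n → Set
    Chart w = Σ[ φ ∈ (Fin m → Fin m) ] (Injective _≡_ _≡_ φ ×
      (∀ k → u k ≡ w → φ (lab (σ k)) ≡ a k × (∀ e → Star (B.E e) (a k) (φ (τ w e)))))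

    -- In colour `e`, each terminal reaches the alternating copy within its own copy of `H`;
    -- geodesics of `T i₀` then lead all of them to one vertex over `u zero`.
    spread : (∀ w → Chart w) → ∀ {S} → Covers (λ k → u k , a k) S → ∀ {r} → r ∈ S →
             Packing (G ∘ₗ H) S (t + ℓ * m)
    spread chart cov r∈ = packing u-joins extras
        (λ x∈ → let k , eq = cov x∈ in
                k , trans eq (cong (u k ,_) (sym (proj₁ (proj₂ (proj₂ (chart (u k))) k refl)))))
        r∈
      where
      F : Rel (Fin n) 0ℓ
      F p q = T.E i₀ p q × parity p ≢ parity q

      φ : Fin n → Fin m → Fin m
      φ w = proj₁ (chart w)

      open Colouring 𝓣 𝓑 u (lab ∘ σ) port port-edge
        (λ i k k′ p q → cong lab (port-facing i k k′ p q))
        φ (λ w → proj₁ (proj₂ (chart w)))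
        i₀ {F} (λ p q → T.E? i₀ p q ×-dec ¬? (parity p Bool.≟ parity q))
        (λ (e , p≢q) → T.E-sym i₀ e , p≢q ∘ sym) proj₁ τ
        (λ {w} _ eq → shift-injective (parity w) (lab-inj eq))
        (λ (_ , p≢q) e eq → shift-≢ e p≢q (lab-inj eq))
        (λ {k} _ e eq → σ-avoids _ k refl e (lab-inj eq))

      toRoot : ∀ k → Star F (u k) (u zero)
      toRoot k = proj₂ (proj₂ (bipartite (T.E? i₀) (u zero))) (u-joins i₀ k zero)

      toTwist : ∀ e k → Star (Colour (inj₁ e)) (terminal k) (u k , φ (u k) (τ (u k) e))
      toTwist e k = let a≡ , joined = proj₂ (proj₂ (chart (u k))) k refl in
        copies (subst (λ z → Star (B.E e) z (φ (u k) (τ (u k) e))) (sym a≡) (joined e))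

      extras : ∀ e k k′ → Star (Colour (inj₁ e)) (terminal k) (terminal k′)
      extras e k k′ = toTwist e k ◅◅ twists
        (toRoot k ◅◅ Star.reverse (λ (e , p≢q) → T.E-sym i₀ e , p≢q ∘ sym) (toRoot k′))
        ◅◅ Star.reverse (colour-sym (inj₁ e)) (toTwist e k′)

    -- The neighbours of `x` in the disjoint `B e` are distinct, so they can take the labels
    -- `shift b e` next to `x` itself.
    neighbourChart : ∀ b {S} → ∀ {x} → x ∈ S → Joins 𝓑 S → ∣ S ∣ ≡ 3 →
                     Σ[ φ ∈ (Fin m → Fin m) ] (Injective _≡_ _≡_ φ × φ (lab zero) ≡ x ×
                       (∀ e → Star (B.E e) x (φ (lab (shift b e)))))
    neighbourChart b {S} {x} x∈ joins ∣S∣ =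
      let φ , φ-inj , agree = extendInjection (lab ∘ (zero Vector.∷ shift b)) (x Vector.∷ y)
            (∷-injective (shift-injective b) (shift-≢0 b) ∘ lab-inj)
            (∷-injective y-inj λ e → B.E-irrefl e (xy e) ∘ sym)
      in φ , φ-inj , agree zero , λ e → subst (B.E e x) (sym (agree (suc e))) (xy e) ◅ ε
      where
      y : Fin t → Fin m
      y e = proj₁ (neighbour 𝓑 ∣S∣ joins e x∈)

      xy : ∀ e → B.E e x (y e)
      xy e = proj₂ (neighbour 𝓑 ∣S∣ joins e x∈)

      y-inj : Injective _≡_ _≡_ y
      y-inj {e} {e′} eq = B.E-unique (xy e) (subst (B.E e′ x) (sym eq) (xy e′))

  -- The possible positions of the three terminals.

  module _ {SG : Subset n} {SH : Subset m} (∣SG∣ : ∣ SG ∣ ≡ 3) (∣SH∣ : ∣ SH ∣ ≡ 3)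
           (joinsG : Joins 𝓣 SG) (joinsH : Joins 𝓑 SH) (i₀ : Fin ℓ) where

    -- The copies of the `B e` over `u` already join the terminals, so `F` is empty, `τ` is a dummy
    -- and the charts are identities. The common port differs from `u`, so no two terminals face
    -- each other.
    packing-same : (u : Fin n) (a : Fin 3 → Fin m) → u ∈ SG → (∀ k → a k ∈ SH) →
                   ∀ {S} → Covers (λ k → u , a k) S → ∀ {r} → r ∈ S → Packing (G ∘ₗ H) S (t + ℓ * m)
    packing-same u a u∈ a∈ = packing (λ _ _ _ → ε) λ e k k′ → copies (joinsH e (a∈ k) (a∈ k′))
      where
      port : ∀ i → ∃ (T.E i u)
      port i = neighbour 𝓣 ∣SG∣ joinsG i u∈

      open Colouring 𝓣 𝓑 (λ _ → u) a (λ i _ → proj₁ (port i)) (λ i _ → proj₂ (port i))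
        (λ i _ _ port≡u _ → contradiction (sym port≡u) (T.E-irrefl i (proj₂ (port i))))
        (λ _ p → p) (λ _ eq → eq) i₀ {λ _ _ → Empty} (λ _ _ → no λ ()) (λ ()) (λ ())
        (λ _ _ → a zero) (λ ()) (λ ()) (λ ())

    -- Two vertices of `SH` together with `t` representatives outside them are distinct vertices of
    -- `H`.
    2+t≤m : 2 + t ≤ m
    2+t≤m = let a , a∈ = member SH (subst (1 ≤_) (sym ∣SH∣) (s≤s z≤n))
                b , b∈ , b≢a , _ = thirdElement SH ∣SH∣ a a
                z , z∈ , z≢a , z≢b = thirdElement SH ∣SH∣ a b
            in Sum.[ bound (b≢a ∘ sym) , bound b≢a ]′
                 (representatives 𝓑 (b≢a ∘ sym) z≢a z≢b (λ e → joinsH e a∈ z∈) (λ e → joinsH e b∈ a∈))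
      where
      bound : ∀ {a b} → a ≢ b → Representatives 𝓑 a b → 2 + t ≤ m
      bound a≢b (y , y-inj , y≢ , _) = injective⇒≤ (pairInjection a≢b y-inj y≢)

    -- No vertex of `G` carries two terminals, so all of them take the label `zero`, and ports may
    -- face each other.
    packing-distinct : (u : Fin 3 → Fin n) (a : Fin 3 → Fin m) → Injective _≡_ _≡_ u →
                       (∀ k → u k ∈ SG) → (∀ k → a k ∈ SH) →
                       ∀ {S} → Covers (λ k → u k , a k) S → ∀ {r} → r ∈ S →
                       Packing (G ∘ₗ H) S (t + ℓ * m)
    packing-distinct u a u-inj u∈ a∈ = spread chart
      where
      open Spread i₀ 2+t≤m u a (λ i k k′ → joinsG i (u∈ k) (u∈ k′)) (λ _ → zero)
        (λ i k → proj₁ (neighbour 𝓣 ∣SG∣ joinsG i (u∈ k)))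
        (λ i k → proj₂ (neighbour 𝓣 ∣SG∣ joinsG i (u∈ k)))
        (λ _ _ _ _ _ → refl) (λ b _ _ → shift-≢0 b)

      chart : ∀ w → Chart w
      chart w with any? (λ k → u k ≟ w)
      ... | no none = id , id , λ k uk≡w → contradiction (k , uk≡w) none
      ... | yes (k , refl) = let φ , φ-inj , φ0 , φτ = neighbourChart (parity w) (a∈ k) joinsH ∣SH∣ in
        φ , φ-inj , λ k′ eq → case u-inj eq of λ { refl → φ0 , φτ }

    -- Parity is measured from `u`, which is therefore even and has `suc zero` free for its second
    -- terminal `(u , b)`. That label differs from the one of `(v , c)`, so the ports of `u` and `v`
    -- must not face each other.
    packing-pair : ∀ {u v a b c} → u ≢ v → a ≢ b → u ∈ SG → v ∈ SG → a ∈ SH → b ∈ SH → c ∈ SH →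
                   Representatives 𝓑 a b →
                   ∀ {S} → Covers (lookup ((u , a) ∷ (u , b) ∷ (v , c) ∷ [])) S → ∀ {r} → r ∈ S →
                   Packing (G ∘ₗ H) S (t + ℓ * m)
    packing-pair {u} {v} {a} {b} {c} u≢v a≢b u∈ v∈ a∈ b∈ c∈ (y , y-inj , y≢ , ay) cov =
      spread chart λ x∈ → case cov x∈ of λ where
        (zero , eq)           → zero , eq
        (suc zero , eq)       → suc zero , eq
        (suc (suc zero) , eq) → suc (suc zero) , eq
      where
      U : Fin 3 → Fin n
      U = lookup (u ∷ u ∷ v ∷ [])

      U∈ : ∀ k → U k ∈ SG
      U∈ zero             = u∈
      U∈ (suc zero)       = u∈
      U∈ (suc (suc zero)) = v∈

      σ : Fin 3 → Fin (2 + t)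
      σ = lookup (zero ∷ suc zero ∷ zero ∷ [])

      Ports : Fin ℓ → Set
      Ports i = Σ[ port ∈ (Fin 3 → Fin n) ] ((∀ k → T.E i (U k) (port k)) ×
                (∀ k k′ → port k ≡ U k′ → port k′ ≡ U k → σ k ≡ σ k′))

      mkPorts : ∀ i {p q} → T.E i u p → T.E i v q → p ≢ v ⊎ q ≢ u → Ports i
      mkPorts i {p} {q} up vq away = lookup (p ∷ p ∷ q ∷ []) , edge , facing
        where
        edge : ∀ k → T.E i (U k) (lookup (p ∷ p ∷ q ∷ []) k)
        edge zero             = up
        edge (suc zero)       = up
        edge (suc (suc zero)) = vq

        not-u : p ≡ u → zero {1 + t} ≡ suc zero
        not-u p≡u = contradiction (sym p≡u) (T.E-irrefl i up)

        not-uv : p ≡ v → q ≡ u → zero {1 + t} ≡ suc zero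
        not-uv p≡v q≡u = ⊥-elim (Sum.[ (λ p≢v → p≢v p≡v) , (λ q≢u → q≢u q≡u) ]′ away)

        facing : ∀ k k′ → lookup (p ∷ p ∷ q ∷ []) k ≡ U k′ →
                 lookup (p ∷ p ∷ q ∷ []) k′ ≡ U k → σ k ≡ σ k′
        facing zero             zero             _ _ = refl
        facing zero             (suc zero)       e _ = not-u e
        facing zero             (suc (suc zero)) _ _ = refl
        facing (suc zero)       zero             e _ = sym (not-u e)
        facing (suc zero)       (suc zero)       _ _ = refl
        facing (suc zero)       (suc (suc zero)) e f = sym (not-uv e f)
        facing (suc (suc zero)) zero             _ _ = refl
        facing (suc (suc zero)) (suc zero)       e f = not-uv f e
        facing (suc (suc zero)) (suc (suc zero)) _ _ = refl

      -- T.E i reaches a vertex outside {u , v}, so u and v need not be each other's port.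
      ports : ∀ i → Ports i
      ports i = let z , z∈ , z≢u , z≢v = thirdElement SG ∣SG∣ u v
                    p , up = neighbour 𝓣 ∣SG∣ joinsG i u∈
                    q , vq = neighbour 𝓣 ∣SG∣ joinsG i v∈
                in case escape u v z≢u z≢v (joinsG i u∈ z∈) of λ where
                     (inj₁ (_ , ≢v , uy)) → mkPorts i uy vq (inj₁ ≢v)
                     (inj₂ (_ , ≢u , vy)) → mkPorts i up vy (inj₂ ≢u)

      u-even : proj₁ (bipartite (T.E? i₀) u) u ≡ false
      u-even = proj₁ (proj₂ (bipartite (T.E? i₀) u))

      avoids : ∀ b k → b ≡ proj₁ (bipartite (T.E? i₀) u) (U k) → ∀ e → shift b e ≢ σ k
      avoids b zero             _  e = shift-≢0 b e
      avoids b (suc zero)       eq e with refl ← trans eq u-even = λ ()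
      avoids b (suc (suc zero)) _  e = shift-≢0 b e

      open Spread i₀ 2+t≤m U (lookup (a ∷ b ∷ c ∷ [])) (λ i k k′ → joinsG i (U∈ k) (U∈ k′)) σ
        (λ i → proj₁ (ports i)) (λ i → proj₁ (proj₂ (ports i))) (λ i → proj₂ (proj₂ (ports i))) avoids

      chart : ∀ w → Chart w
      chart w with w ≟ u | w ≟ v
      ... | no w≢u | no w≢v = id , id , λ where
        zero             u≡w → contradiction (sym u≡w) w≢u
        (suc zero)       u≡w → contradiction (sym u≡w) w≢u
        (suc (suc zero)) v≡w → contradiction (sym v≡w) w≢v
      ... | no w≢u | yes refl = let φ , φ-inj , φ0 , φτ = neighbourChart (parity w) c∈ joinsH ∣SH∣ in
        φ , φ-inj , λ where
          zero             u≡w → contradiction (sym u≡w) w≢u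
          (suc zero)       u≡w → contradiction (sym u≡w) w≢u
          (suc (suc zero)) _   → φ0 , φτ
      ... | yes refl | _ =
        let φ , φ-inj , agree = extendInjection lab (a Vector.∷ b Vector.∷ y) lab-inj
                                  (pairInjection a≢b y-inj y≢)
            φτ : ∀ e → φ (τ w e) ≡ y e
            φτ = λ e → trans (cong (λ b → φ (lab (shift b e))) u-even) (agree (suc (suc e)))
            joined : ∀ e → Star (B.E e) a (φ (τ w e))
            joined = λ e → subst (B.E e a) (sym (φτ e)) (ay e) ◅ ε
        in φ , φ-inj , λ where
          zero             _   → agree zero , joined
          -- The representatives are neighbours of `a`, so `b` reaches them through `a`.
          (suc zero)       _   → agree (suc zero) , λ e → joinsH e b∈ a∈ ◅◅ joined e
          (suc (suc zero)) v≡w → contradiction (sym v≡w) u≢v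

    module _ {S : Subset (n * m)} {r} (r∈ : r ∈ S) where

      -- Representatives exist at `a` or at `b`; in the second case the two terminals over `u` swap
      -- roles.
      twoEqual : (x y z : Fin n × Fin m) →
                 (∀ k → proj₁ (lookup (x ∷ y ∷ z ∷ []) k) ∈ SG) →
                 (∀ k → proj₂ (lookup (x ∷ y ∷ z ∷ []) k) ∈ SH) →
                 proj₁ x ≡ proj₁ y → proj₁ x ≢ proj₁ z → x ≢ y →
                 Covers (lookup (x ∷ y ∷ z ∷ [])) S → Packing (G ∘ₗ H) S (t + ℓ * m)
      twoEqual (u , a) (.u , b) (v , c) u∈ a∈ refl u≢v x≢y cov =
        let z , z∈ , z≢a , z≢b = thirdElement SH ∣SH∣ a b in
        Sum.[ (λ reps → packing-pair u≢v a≢b (u∈ zero) (u∈ (suc (suc zero)))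
                          (a∈ zero) (a∈ (suc zero)) (a∈ (suc (suc zero))) reps cov r∈)
            , (λ reps → packing-pair u≢v (a≢b ∘ sym) (u∈ zero) (u∈ (suc (suc zero)))
                          (a∈ (suc zero)) (a∈ zero) (a∈ (suc (suc zero))) reps swapped r∈) ]′
          (representatives 𝓑 a≢b z≢a z≢b (λ e → joinsH e (a∈ zero) z∈)
             (λ e → joinsH e (a∈ (suc zero)) (a∈ zero)))
        where
        a≢b : a ≢ b
        a≢b a≡b = x≢y (cong (u ,_) a≡b)

        swapped : Covers (lookup ((u , b) ∷ (u , a) ∷ (v , c) ∷ [])) S
        swapped x∈ = case cov x∈ of λ where
          (zero , eq)           → suc zero , eq
          (suc zero , eq)       → zero , eq
          (suc (suc zero) , eq) → suc (suc zero) , eq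

      twoEqualAt : (p : Fin 3 → Fin n × Fin m) → Injective _≡_ _≡_ p →
                   (∀ k → proj₁ (p k) ∈ SG) → (∀ k → proj₂ (p k) ∈ SH) → Covers p S →
                   ∀ i j k → proj₁ (p i) ≡ proj₁ (p j) → proj₁ (p i) ≢ proj₁ (p k) → i ≢ j →
                   (∀ l → ∃[ l′ ] l ≡ lookup (i ∷ j ∷ k ∷ []) l′) → Packing (G ∘ₗ H) S (t + ℓ * m)
      twoEqualAt p p-inj u∈ a∈ cov i j k i~j i≁k i≢j onto =
        twoEqual (p i) (p j) (p k)
          (λ { zero → u∈ i ; (suc zero) → u∈ j ; (suc (suc zero)) → u∈ k })
          (λ { zero → a∈ i ; (suc zero) → a∈ j ; (suc (suc zero)) → a∈ k })
          i~j i≁k (i≢j ∘ p-inj)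
          λ x∈ → let l , eq = cov x∈ ; l′ , l≡ = onto l in
                 l′ , trans eq (trans (cong p l≡) (sym (lookup-map l′ p (i ∷ j ∷ k ∷ []))))

      packing-lex : (p : Fin 3 → Fin n × Fin m) → Injective _≡_ _≡_ p →
                    (∀ k → proj₁ (p k) ∈ SG) → (∀ k → proj₂ (p k) ∈ SH) → Covers p S →
                    Packing (G ∘ₗ H) S (t + ℓ * m)
      packing-lex p p-inj u∈ a∈ cov
        with proj₁ (p zero) ≟ proj₁ (p (suc zero)) | proj₁ (p zero) ≟ proj₁ (p (suc (suc zero)))
           | proj₁ (p (suc zero)) ≟ proj₁ (p (suc (suc zero)))
      ... | yes 0≡1 | yes 0≡2 | _ =
        packing-same (proj₁ (p zero)) (proj₂ ∘ p) (u∈ zero) a∈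
          (λ x∈ → let k , eq = cov x∈ in k , trans eq (cong (_, proj₂ (p k)) (same k))) r∈
        where
        same : ∀ k → proj₁ (p k) ≡ proj₁ (p zero)
        same zero             = refl
        same (suc zero)       = sym 0≡1
        same (suc (suc zero)) = sym 0≡2
      ... | yes 0≡1 | no 0≢2 | _ =
        twoEqualAt p p-inj u∈ a∈ cov zero (suc zero) (suc (suc zero)) 0≡1 0≢2 (λ ()) λ where
          zero             → zero , refl
          (suc zero)       → suc zero , refl
          (suc (suc zero)) → suc (suc zero) , refl
      ... | no 0≢1 | yes 0≡2 | _ =
        twoEqualAt p p-inj u∈ a∈ cov zero (suc (suc zero)) (suc zero) 0≡2 0≢1 (λ ()) λ where
          zero             → zero , refl
          (suc zero)       → suc (suc zero) , refl
          (suc (suc zero)) → suc zero , refl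
      ... | no 0≢1 | no 0≢2 | yes 1≡2 =
        twoEqualAt p p-inj u∈ a∈ cov (suc zero) (suc (suc zero)) zero 1≡2 (0≢1 ∘ sym)
          (λ ()) λ where
          zero             → suc (suc zero) , refl
          (suc zero)       → zero , refl
          (suc (suc zero)) → suc zero , refl
      ... | no 0≢1 | no 0≢2 | no 1≢2 =
        packing-distinct (proj₁ ∘ p) (proj₂ ∘ p) u-inj u∈ a∈ cov r∈
        where
        u-inj : Injective _≡_ _≡_ (proj₁ ∘ p)
        u-inj {zero}           {zero}           _ = refl
        u-inj {zero}           {suc zero}       e = contradiction e 0≢1
        u-inj {zero}           {suc (suc zero)} e = contradiction e 0≢2
        u-inj {suc zero}       {zero}           e = contradiction (sym e) 0≢1
        u-inj {suc zero}       {suc zero}       _ = refl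
        u-inj {suc zero}       {suc (suc zero)} e = contradiction e 1≢2
        u-inj {suc (suc zero)} {zero}           e = contradiction (sym e) 0≢2
        u-inj {suc (suc zero)} {suc zero}       e = contradiction (sym e) 1≢2
        u-inj {suc (suc zero)} {suc (suc zero)} _ = refl

-- The lower bound.

lexPacking : {G : Graph n} {H : Graph m} → 3 ≤ n → 3 ≤ m →
             (∀ S → ∣ S ∣ ≡ 3 → Packing G S ℓ) → (∀ S → ∣ S ∣ ≡ 3 → Packing H S t) → Fin ℓ →
             ∀ S → ∣ S ∣ ≡ 3 → Packing (G ∘ₗ H) S (t + ℓ * m)
lexPacking {n} {m} 3≤n 3≤m packG packH i₀ S ∣S∣ =
  let f , f-inj , mem , onto = subst Enumeration ∣S∣ (enumerate S)
      SG , ∣SG∣ , u∈  = coverOfSize 3≤n (proj₁ ∘ remQuot m ∘ f)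
      SH , ∣SH∣ , a∈  = coverOfSize 3≤m (proj₂ ∘ remQuot {n} m ∘ f)
      𝓣 , joinsG = fromPacking (packG SG ∣SG∣)
      𝓑 , joinsH = fromPacking (packH SH ∣SH∣)
  in packing-lex 𝓣 𝓑 ∣SG∣ ∣SH∣ joinsG joinsH i₀ (mem zero) (remQuot m ∘ f)
       (λ eq → f-inj (remQuot-injective eq)) u∈ a∈
       λ x∈ → let k , eq = onto x∈ in k , cong (remQuot m) (sym eq)
  where
  Enumeration : ℕ → Set
  Enumeration c = Σ[ f ∈ (Fin c → Fin (n * m)) ]
    (Injective _≡_ _≡_ f × (∀ i → f i ∈ S) × (∀ {x} → x ∈ S → ∃[ i ] f i ≡ x))

  remQuot-injective : ∀ {x y} → remQuot {n} m x ≡ remQuot m y → x ≡ y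
  remQuot-injective {x} {y} eq = trans (sym (combine-remQuot {n} m x))
    (trans (cong (λ (q , r) → combine q r) eq) (combine-remQuot {n} m y))

-- The whole edge set is a family with one member, which joins every `S`.
1≤λ₃ : (G : Graph n) → 3 ≤ n → Connected G → 1 ≤ λ[ 3 ] G
1≤λ₃ G 3≤n conn = λ₃-greatest G 3≤n conn λ S ∣S∣ →
  toPacking whole (λ _ {x} {y} _ _ → conn x y) (proj₂ (member S (subst (1 ≤_) (sym ∣S∣) (s≤s z≤n))))
    id λ eq → eq
  where
  whole : Family G (Fin 1)
  whole = record
    { E        = λ _ → Adj G
    ; E?       = λ _ → adj? G
    ; E-sym    = λ _ → symm G
    ; E⇒adj    = λ _ → id
    ; E-unique = λ { {zero} {zero} _ _ → refl }
    }

connectedFromPackings : (G : Graph n) → 3 ≤ n → (∀ S → ∣ S ∣ ≡ 3 → Packing G S t) → Fin t → Connected G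
connectedFromPackings G 3≤n packings i x y =
  -- Two vertices are to be joined, so `x` is repeated and the set padded to size three.
  let S , ∣S∣ , mem = coverOfSize 3≤n (lookup (x ∷ x ∷ y ∷ []))
      F , joins = fromPacking (packings S ∣S∣)
  in Star.map (Family.E⇒adj F i) (joins i (mem zero) (mem (suc (suc zero))))

lowerBound : (G : Graph n) (H : Graph m) → 3 ≤ n → 3 ≤ m → Connected G →
             λ[ 3 ] (G ∘ₗ H) ≥ λ[ 3 ] H + λ[ 3 ] G * m
lowerBound {n} {m} G H 3≤n 3≤m conn =
  λ₃-greatest (G ∘ₗ H) 3≤nm
    (connectedFromPackings (G ∘ₗ H) 3≤nm packings (fromℕ< 0<count)) packings
  where
  3≤nm : 3 ≤ n * m
  3≤nm = ℕ.≤-trans (s≤s (s≤s (s≤s z≤n))) (ℕ.*-mono-≤ 3≤n 3≤m)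
  1≤ℓ : 1 ≤ λ[ 3 ] G
  1≤ℓ = 1≤λ₃ G 3≤n conn
  0<count : 0 < λ[ 3 ] H + λ[ 3 ] G * m
  0<count = ℕ.≤-trans (ℕ.*-mono-≤ 1≤ℓ (ℕ.≤-trans (s≤s z≤n) 3≤m)) (ℕ.m≤n+m _ (λ[ 3 ] H))
  packings : ∀ S → ∣ S ∣ ≡ 3 → Packing (G ∘ₗ H) S (λ[ 3 ] H + λ[ 3 ] G * m)
  -- The last argument is `i₀`, the member of the packing of `G` that carries the alternating
  -- copies; connectivity of `G` provides it.
  packings = lexPacking 3≤n 3≤m (λ _ → λ₃-packing G 3≤n) (λ _ → λ₃-packing H 3≤m) (fromℕ< 1≤ℓ)

-- Sharpness.

degreeBound : (G : Graph n) → 3 ≤ n → (x : Fin n) (f : Fin n → Fin t) →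
              (∀ {y z} → Adj G x y → Adj G x z → f y ≡ f z → y ≡ z) → λ[ 3 ] G ≤ t
degreeBound G 3≤n x f f-inj =
  let S , ∣S∣ , mem = coverOfSize 3≤n λ _ → x
      F , joins     = fromPacking (λ₃-packing G 3≤n ∣S∣)
      open Family F
      edge          = λ i → neighbour F ∣S∣ joins i (mem zero)
  -- Disjoint trees through `x` use different edges at `x`, and `f` numbers the neighbours of `x`
  -- without repetition.
  in injective⇒≤ {f = f ∘ proj₁ ∘ edge} λ {i} {j} eq → E-unique (proj₂ (edge i))
       (subst (E j x) (sym (f-inj (E⇒adj i (proj₂ (edge i))) (E⇒adj j (proj₂ (edge j))) eq))
              (proj₂ (edge j)))

path₃ : Graph 3
path₃ = record
  { Adj    = λ x y → x ≢ y × (x ≡ suc zero ⊎ y ≡ suc zero)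
  ; adj?   = λ x y → ¬? (x ≟ y) ×-dec ((x ≟ suc zero) ⊎-dec (y ≟ suc zero))
  ; symm   = λ (x≢y , mid) → x≢y ∘ sym , Sum.swap mid
  ; irrefl = λ x≡y (x≢y , _) → x≢y x≡y
  }

edgeless : ∀ n → Graph n
edgeless n = record
  { Adj = λ _ _ → Empty ; adj? = λ _ _ → no λ () ; symm = λ () ; irrefl = λ _ () }

path₃-connected : Connected path₃
path₃-connected x y = toMid x ◅◅ Star.reverse (symm path₃) (toMid y)
  where
  toMid : ∀ x → Star (Adj path₃) x (suc zero)
  toMid x with x ≟ suc zero
  ... | yes refl = ε
  ... | no x≢mid = (x≢mid , inj₂ refl) ◅ ε

-- The left side is at most 3 by the degree bound, and the right side is at least 3 because
-- `λ[ 3 ] path₃` is at least 1.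
sharp : λ[ 3 ] (path₃ ∘ₗ edgeless 3) ≡ λ[ 3 ] (edgeless 3) + λ[ 3 ] path₃ * 3
sharp = ℕ.≤-antisym
  (ℕ.≤-trans upper
    (ℕ.≤-trans (ℕ.*-monoˡ-≤ 3 (1≤λ₃ path₃ ℕ.≤-refl path₃-connected))
               (ℕ.m≤n+m _ (λ[ 3 ] (edgeless 3)))))
  (lowerBound path₃ (edgeless 3) ℕ.≤-refl ℕ.≤-refl path₃-connected)
  where
  mid : ∀ {y} → LexAdj path₃ (edgeless 3) (zero , zero) y → proj₁ y ≡ suc zero
  mid (inj₁ (_ , inj₂ eq)) = eq
  upper : λ[ 3 ] (path₃ ∘ₗ edgeless 3) ≤ 3
  -- All neighbours of `(zero , zero)` lie over the middle vertex of the path, so the second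
  -- coordinate tells them apart.
  upper = degreeBound (path₃ ∘ₗ edgeless 3) (s≤s (s≤s (s≤s z≤n))) zero (proj₂ ∘ remQuot {3} 3)
    λ {y} {z} xy xz eq → trans (sym (combine-remQuot {3} 3 y))
      (trans (cong₂ combine (trans (mid {remQuot 3 y} xy) (sym (mid {remQuot 3 z} xz))) eq)
             (combine-remQuot {3} 3 z))

theorem1 : (∀ {n m : ℕ} (G : Graph n) (H : Graph m) →
    3 ≤ n → 3 ≤ m → Connected G →
    λ[ 3 ] (G ∘ₗ H) ≥ λ[ 3 ] H + λ[ 3 ] G * m)
    ×
    (∃[ n ] ∃[ m ] Σ[ G ∈ Graph n ] Σ[ H ∈ Graph m ]
    (3 ≤ n × 3 ≤ m × Connected G ×
    λ[ 3 ] (G ∘ₗ H) ≡ λ[ 3 ] H + λ[ 3 ] G * m))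
theorem1 = lowerBound
         , 3 , 3 , path₃ , edgeless 3 , ℕ.≤-refl , ℕ.≤-refl , path₃-connected , sharp
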